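{- Let $m > 1$ be an integer and $a$ an integer such that $\gcd(a,m)$ is square-free, and let $\gamma \in \{\pi/4, 3\pi/4\}$. Then the congruence class of $a$ modulo $m$ contains infinitely many square-free $\gamma$-congruent numbers.
   Context: For $\theta \in \{\pi/4,3\pi/4\}$, a positive integer $n$ is $\theta$-congruent if there exist positive rationals $a,b,c$ such that the triangle with sides $a$, $b\sqrt2$, $c$ has angle $\theta$ opposite $c$ and area $n$; equivalently $ab = 2n$ and $c^2 = a^2+2b^2-2ab$ (for $\theta = \pi/4$), resp. $c^2 = a^2+2b^2+2ab$ (for $\theta=3\pi/4$). -}

module Defs where

open import Data.Integer as ℤ using (ℤ; +_)
open import Data.Integer.Divisibility as ℤ using ()
open import Data.Nat as ℕ using (ℕ)
open import Data.Nat.Divisibility as ℕ using ()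
open import Data.Product using (∃; _×_)
open import Data.Rational using (ℚ; 0ℚ; _<_; _+_; _-_; _*_; _/_)
open import Relation.Binary.PropositionalEquality using (_≡_)

-- 0 is not square-free.
SquareFree : ℕ → Set
SquareFree n = ∀ d → (d ℕ.* d) ℕ.∣ n → d ≡ 1

infix 4 _≡_[mod_]

_≡_[mod_] : ℤ → ℤ → ℤ → Set
x ≡ y [mod m ] = m ℤ.∣ (x ℤ.- y)

Infinitely : (ℕ → Set) → Set
Infinitely P = ∀ N → ∃ λ n → N ℕ.< n × P n

data Angle : Set where
  π/4 3π/4 : Angle

2ℚ : ℚ
2ℚ = + 2 / 1

-- The square of the side opposite the angle θ enclosed by sides of length
-- a and b√2, by the law of cosines with cos θ = ±√2/2:
-- a² + (b√2)² - 2·a·(b√2)·cos θ = a² + 2b² ∓ 2ab.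
oppositeSideSquared : Angle → ℚ → ℚ → ℚ
oppositeSideSquared π/4  a b = a * a + 2ℚ * (b * b) - 2ℚ * (a * b)
oppositeSideSquared 3π/4 a b = a * a + 2ℚ * (b * b) + 2ℚ * (a * b)

-- The triangle has sides a, b√2, c with the angle θ opposite c.  Since
-- sin θ = √2/2 for both angles, its area ½·a·(b√2)·sin θ is ab/2.
record CongruentTriangle (θ : Angle) (n : ℕ) : Set where
  field
    a b c          : ℚ
    a-positive     : 0ℚ < a
    b-positive     : 0ℚ < b
    c-positive     : 0ℚ < c
    area           : a * b ≡ 2ℚ * (+ n / 1)
    law-of-cosines : c * c ≡ oppositeSideSquared θ a b

Congruent : Angle → ℕ → Set
Congruent θ n = 0 ℕ.< n × CongruentTriangle θ n

{-# OPTIONS --safe #-}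
module Submission where

-- Write F(p, w) = p² ± 2pw − w², with sign + for π/4 and − for 3π/4.  If
-- p w F(p, w) = n d², then F/d, 2pw/d and (p² + w²)/d are the sides a, b, c of
-- a triangle of area n.  Let g = gcd(a, m), and let s be a multiple of m and
-- of all small primes.  There is u ≡ a/g mod m/g prime to s; take u x ≡ 1
-- mod s, p = u² x, w = g s²ⁱ with i ≥ 1.  Then n = g x F(p, w) is congruent,
-- and x F ≡ u mod s, so n ≡ a mod m and only primes ℓ ∤ s matter for
-- square-freeness.
--
-- Let x run over R terms of its progression mod s and i over H values.  For a
-- fixed i, the x with ℓ² ∣ x or ℓ² ∣ F lie in at most three classes mod ℓ²,
-- which for L < ℓ ≤ B = O(√R) excludes O(R/L + B) values of x.  For ℓ > B,
-- F(p, w) ≡ 0 has two roots p/w mod ℓ², and two pairs (p, w) with the same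
-- root have p w′ − p′ w ≡ 0 mod ℓ²; this number is smaller than ℓ², hence
-- zero, and the pairs agree.  So each ℓ > B excludes at most two pairs (x, i)
-- altogether, and ℓ ≤ C R with C independent of H.  Taking H large compared
-- with C, fewer than H R pairs are excluded.

import Data.Integer as ℤ
import Data.Integer.DivMod as ℤ
import Data.Integer.Divisibility.Signed as ℤ
import Data.Integer.GCD as ℤ
import Data.Integer.Properties as ℤ
import Data.Integer.Tactic.RingSolver as ℤ-Solver
import Data.Nat as ℕ
import Data.Nat.Divisibility as ℕ
import Data.Nat.Properties as ℕ
open import Data.Product using (_×_; _,_; ∃; ∃₂)
open import Data.Sum as Sum using (_⊎_; inj₁; inj₂; [_,_]′)
open import Relation.Binary using (tri<; tri≈; tri>)
open import Relation.Binary.PropositionalEquality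
open import Relation.Nullary using (¬_; Dec; yes; no; contradiction)
open import Defs

-- Roots of the binary form modulo the square of an odd prime.

module BinaryForm where

  open import Data.Integer using (ℤ; +_; _+_; _*_; _-_; ∣_∣)
  open import Data.Integer.Divisibility.Signed
    using (∣ᵤ⇒∣; ∣⇒∣ᵤ; ∣-trans; ∣m⇒∣m*n; ∣n⇒∣m*n; ∣m∣n⇒∣m+n; ∣m∣n⇒∣m-n)
    renaming (_∣_ to _∣ℤ_; _∣?_ to _∣ℤ?_)
  open import Data.Integer.Properties using (abs-*; *-comm)
  open import Data.Integer.Tactic.RingSolver using (solve-∀)
  open import Data.Nat using (ℕ)
  open import Data.Nat.Primality using (Prime; euclidsLemma; prime⇒nonZero)

  euclid : ∀ {ℓ} x y → Prime ℓ → + ℓ ∣ℤ x * y → + ℓ ∣ℤ x ⊎ + ℓ ∣ℤ y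
  euclid x y ℓ-prime ℓ∣xy = Sum.map ∣ᵤ⇒∣ ∣ᵤ⇒∣
    (euclidsLemma ∣ x ∣ ∣ y ∣ ℓ-prime (subst (_ ℕ.∣_) (abs-* x y) (∣⇒∣ᵤ ℓ∣xy)))

  ∤-* : ∀ {ℓ x y} → Prime ℓ → ¬ + ℓ ∣ℤ x → ¬ + ℓ ∣ℤ y → ¬ + ℓ ∣ℤ x * y
  ∤-* {x = x} {y} ℓ-prime ℓ∤x ℓ∤y ℓ∣xy = [ ℓ∤x , ℓ∤y ]′ (euclid x y ℓ-prime ℓ∣xy)

  square-euclidℕ : ∀ {ℓ} x y → Prime ℓ → ¬ ℓ ℕ.∣ x → ℓ ℕ.* ℓ ℕ.∣ x ℕ.* y → ℓ ℕ.* ℓ ℕ.∣ y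
  square-euclidℕ {ℓ} x y ℓ-prime ℓ∤x ℓ²∣xy with euclidsLemma x y ℓ-prime (ℕ.m*n∣⇒m∣ ℓ ℓ ℓ²∣xy)
  ... | inj₁ ℓ∣x = contradiction ℓ∣x ℓ∤x
  ... | inj₂ (ℕ.divides q refl)
    with euclidsLemma x q ℓ-prime (ℕ.*-cancelʳ-∣ ℓ {{prime⇒nonZero ℓ-prime}}
           (subst (ℓ ℕ.* ℓ ℕ.∣_) (sym (ℕ.*-assoc x q ℓ)) ℓ²∣xy))
  ... | inj₁ ℓ∣x = contradiction ℓ∣x ℓ∤x
  ... | inj₂ ℓ∣q = ℕ.*-monoˡ-∣ ℓ ℓ∣q

  square-euclid : ∀ {ℓ} x y → Prime ℓ → ¬ + ℓ ∣ℤ x → + (ℓ ℕ.* ℓ) ∣ℤ x * y → + (ℓ ℕ.* ℓ) ∣ℤ y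
  square-euclid x y ℓ-prime ℓ∤x ℓ²∣xy = ∣ᵤ⇒∣ (square-euclidℕ ∣ x ∣ ∣ y ∣ ℓ-prime
    (λ ℓ∣x → ℓ∤x (∣ᵤ⇒∣ ℓ∣x)) (subst (_ ℕ.∣_) (abs-* x y) (∣⇒∣ᵤ ℓ²∣xy)))

  ℓ²∣⇒ℓ∣ : ∀ {ℓ x} → + (ℓ ℕ.* ℓ) ∣ℤ x → + ℓ ∣ℤ x
  ℓ²∣⇒ℓ∣ {ℓ} = ∣-trans (∣ᵤ⇒∣ (ℕ.m∣m*n ℓ))

  form : ℤ → ℤ → ℤ → ℤ
  form ε p w = p * p + + 2 * ε * (p * w) - w * w

  module _ {ε : ℤ} (ε²≡1 : ε * ε ≡ + 1) {ℓ : ℕ} (ℓ-prime : Prime ℓ) (ℓ∤2 : ¬ + ℓ ∣ℤ + 2) where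

    private
      -- Rules out a double root: if ℓ divides the form and also `p + ε * w`, it divides
      -- `2 * (w * w)`.
      complete-square : ∀ p w → (p + ε * w) * (p + ε * w) - form ε p w ≡ + 2 * (w * w)
      complete-square p w = trans (expand ε p w) (trans (cong (λ e → e * (w * w) + w * w) ε²≡1) (collect (w * w)))
        where
        expand : ∀ e p w → (p + e * w) * (p + e * w) - (p * p + + 2 * e * (p * w) - w * w) ≡ e * e * (w * w) + w * w
        expand = solve-∀
        collect : ∀ z → + 1 * z + z ≡ + 2 * z
        collect = solve-∀

      -- The roots of X² + 2eX - 1 add up to -2e. The first factor vanishes when p/w and p′/w′ are
      -- the same root, the second when they are conjugate roots.
      factorisation : ∀ e p w p′ w′ →
        (p * p + + 2 * e * (p * w) - w * w) * (w′ * w′) - (p′ * p′ + + 2 * e * (p′ * w′) - w′ * w′) * (w * w)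
          ≡ (p * w′ - p′ * w) * (p * w′ + p′ * w + + 2 * e * (w * w′))
      factorisation = solve-∀

      sum-of-factors : ∀ e p w p′ w′ →
        (p * w′ - p′ * w) + (p * w′ + p′ * w + + 2 * e * (w * w′)) ≡ + 2 * w′ * (p + e * w)
      sum-of-factors = solve-∀

      -- Two quotients conjugate to the same p₁/w₁ agree with each other.
      eliminate : ∀ e p₁ w₁ p₂ w₂ p₃ w₃ →
        w₃ * (p₁ * w₂ + p₂ * w₁ + + 2 * e * (w₁ * w₂)) - w₂ * (p₁ * w₃ + p₃ * w₁ + + 2 * e * (w₁ * w₃))
          ≡ w₁ * (p₂ * w₃ - p₃ * w₂)
      eliminate = solve-∀

    -- By `factorisation`, ℓ² divides a product A B. If ℓ divided both factors, it would divide
    -- their sum `2 * w′ * (p + ε * w)`, hence `p + ε * w`, and then 2w² by `complete-square`. So ℓ²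
    -- divides one factor alone.
    same-or-conjugate-root : ∀ p w p′ w′ → ¬ + ℓ ∣ℤ w → ¬ + ℓ ∣ℤ w′ →
      + (ℓ ℕ.* ℓ) ∣ℤ form ε p w → + (ℓ ℕ.* ℓ) ∣ℤ form ε p′ w′ →
      + (ℓ ℕ.* ℓ) ∣ℤ p * w′ - p′ * w ⊎ + (ℓ ℕ.* ℓ) ∣ℤ p * w′ + p′ * w + + 2 * ε * (w * w′)
    same-or-conjugate-root p w p′ w′ ℓ∤w ℓ∤w′ ℓ²∣F ℓ²∣F′ with + ℓ ∣ℤ? (p * w′ - p′ * w)
    ... | no ℓ∤A = inj₂ (square-euclid _ _ ℓ-prime ℓ∤A ℓ²∣AB)
      where
      ℓ²∣AB = subst (+ (ℓ ℕ.* ℓ) ∣ℤ_) (factorisation ε p w p′ w′)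
                (∣m∣n⇒∣m-n (∣m⇒∣m*n (w′ * w′) ℓ²∣F) (∣m⇒∣m*n (w * w) ℓ²∣F′))
    ... | yes ℓ∣A = inj₁ (square-euclid (p * w′ + p′ * w + + 2 * ε * (w * w′)) (p * w′ - p′ * w) ℓ-prime ℓ∤B ℓ²∣BA)
      where
      ℓ²∣BA = subst (+ (ℓ ℕ.* ℓ) ∣ℤ_) (trans (factorisation ε p w p′ w′) (*-comm (p * w′ - p′ * w) _))
                (∣m∣n⇒∣m-n (∣m⇒∣m*n (w′ * w′) ℓ²∣F) (∣m⇒∣m*n (w * w) ℓ²∣F′))
      ℓ∤B : ¬ + ℓ ∣ℤ p * w′ + p′ * w + + 2 * ε * (w * w′)
      ℓ∤B ℓ∣B with euclid (+ 2 * w′) (p + ε * w) ℓ-prime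
                     (subst (+ ℓ ∣ℤ_) (sum-of-factors ε p w p′ w′) (∣m∣n⇒∣m+n ℓ∣A ℓ∣B))
      ... | inj₁ ℓ∣2w′ = ∤-* ℓ-prime ℓ∤2 ℓ∤w′ ℓ∣2w′
      ... | inj₂ ℓ∣p+εw = ∤-* ℓ-prime ℓ∤2 (∤-* ℓ-prime ℓ∤w ℓ∤w)
            (subst (+ ℓ ∣ℤ_) (complete-square p w)
              (∣m∣n⇒∣m-n (∣m⇒∣m*n (p + ε * w) ℓ∣p+εw) (ℓ²∣⇒ℓ∣ ℓ²∣F)))

    -- The quotient p/w is one of two roots modulo ℓ².
    two-roots : ∀ p₁ w₁ p₂ w₂ p₃ w₃ → ¬ + ℓ ∣ℤ w₁ → ¬ + ℓ ∣ℤ w₂ → ¬ + ℓ ∣ℤ w₃ →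
      + (ℓ ℕ.* ℓ) ∣ℤ form ε p₁ w₁ → + (ℓ ℕ.* ℓ) ∣ℤ form ε p₂ w₂ → + (ℓ ℕ.* ℓ) ∣ℤ form ε p₃ w₃ →
      + (ℓ ℕ.* ℓ) ∣ℤ p₁ * w₂ - p₂ * w₁ ⊎ + (ℓ ℕ.* ℓ) ∣ℤ p₁ * w₃ - p₃ * w₁ ⊎ + (ℓ ℕ.* ℓ) ∣ℤ p₂ * w₃ - p₃ * w₂
    two-roots p₁ w₁ p₂ w₂ p₃ w₃ ℓ∤w₁ ℓ∤w₂ ℓ∤w₃ d₁ d₂ d₃
      with same-or-conjugate-root p₁ w₁ p₂ w₂ ℓ∤w₁ ℓ∤w₂ d₁ d₂ | same-or-conjugate-root p₁ w₁ p₃ w₃ ℓ∤w₁ ℓ∤w₃ d₁ d₃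
    ... | inj₁ s | _ = inj₁ s
    ... | inj₂ _ | inj₁ s = inj₂ (inj₁ s)
    ... | inj₂ c₂ | inj₂ c₃ = inj₂ (inj₂ (square-euclid w₁ _ ℓ-prime ℓ∤w₁
            (subst (+ (ℓ ℕ.* ℓ) ∣ℤ_) (eliminate ε p₁ w₁ p₂ w₂ p₃ w₃)
              (∣m∣n⇒∣m-n (∣n⇒∣m*n w₃ c₂) (∣n⇒∣m*n w₂ c₃)))))

  ∣⇒+∣+ : ∀ {d n} → d ℕ.∣ n → + d ∣ℤ + n
  ∣⇒+∣+ = ∣ᵤ⇒∣

-- From a value of the form to a rational triangle.

module Triangle where

  open import Data.Integer using (ℤ; +_; -[1+_])
  open import Data.Rational using (ℚ; 1ℚ; _/_; _+_; _*_; _-_; -_; 1/_; toℚᵘ; Positive; positive)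
  import Data.Rational.Properties as ℚ
  open import Data.Rational.Solver using (module +-*-Solver)
  import Data.Rational.Unnormalised as ℚᵘ
  import Data.Rational.Unnormalised.Properties as ℚᵘ
  open BinaryForm using (form)

  ι : ℤ → ℚ
  ι z = z / 1

  -- Normalised fractions hide a gcd, so the homomorphism laws of `ι` are checked on unnormalised
  -- ones. The argument 0 of `mkℚᵘ` is the denominator minus one.
  toℚᵘ-ι : ∀ z → toℚᵘ (ι z) ℚᵘ.≃ ℚᵘ.mkℚᵘ z 0
  toℚᵘ-ι z = ℚ.toℚᵘ-fromℚᵘ (ℚᵘ.mkℚᵘ z 0)

  ι-+ : ∀ x y → ι (x ℤ.+ y) ≡ ι x + ι y
  ι-+ x y = ℚ.toℚᵘ-injective (begin
    toℚᵘ (ι (x ℤ.+ y))                 ≈⟨ toℚᵘ-ι (x ℤ.+ y) ⟩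
    ℚᵘ.mkℚᵘ (x ℤ.+ y) 0                ≈⟨ ℚᵘ.*≡* (identity x y) ⟩
    ℚᵘ.mkℚᵘ x 0 ℚᵘ.+ ℚᵘ.mkℚᵘ y 0       ≈⟨ ℚᵘ.+-cong (toℚᵘ-ι x) (toℚᵘ-ι y) ⟨
    toℚᵘ (ι x) ℚᵘ.+ toℚᵘ (ι y)         ≈⟨ ℚ.toℚᵘ-homo-+ (ι x) (ι y) ⟨
    toℚᵘ (ι x + ι y)                   ∎)
    where
    open ℚᵘ.≃-Reasoning
    identity : ∀ x y → (x ℤ.+ y) ℤ.* + 1 ≡ (x ℤ.* + 1 ℤ.+ y ℤ.* + 1) ℤ.* + 1
    identity = ℤ-Solver.solve-∀

  ι-* : ∀ x y → ι (x ℤ.* y) ≡ ι x * ι y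
  ι-* x y = ℚ.toℚᵘ-injective (begin
    toℚᵘ (ι (x ℤ.* y))                 ≈⟨ toℚᵘ-ι (x ℤ.* y) ⟩
    ℚᵘ.mkℚᵘ x 0 ℚᵘ.* ℚᵘ.mkℚᵘ y 0       ≈⟨ ℚᵘ.*-cong (toℚᵘ-ι x) (toℚᵘ-ι y) ⟨
    toℚᵘ (ι x) ℚᵘ.* toℚᵘ (ι y)         ≈⟨ ℚ.toℚᵘ-homo-* (ι x) (ι y) ⟨
    toℚᵘ (ι x * ι y)                   ∎)
    where open ℚᵘ.≃-Reasoning

  ι-- : ∀ x → ι (ℤ.- x) ≡ - ι x
  ι-- x = ℚ.toℚᵘ-injective (begin
    toℚᵘ (ι (ℤ.- x))                   ≈⟨ toℚᵘ-ι (ℤ.- x) ⟩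
    ℚᵘ.- ℚᵘ.mkℚᵘ x 0                   ≈⟨ ℚᵘ.-‿cong (toℚᵘ-ι x) ⟨
    ℚᵘ.- toℚᵘ (ι x)                    ≈⟨ ℚ.toℚᵘ-homo‿- (ι x) ⟨
    toℚᵘ (- ι x)                       ∎)
    where open ℚᵘ.≃-Reasoning

  ι-positive : ∀ {z} → + 0 ℤ.< z → Positive (ι z)
  ι-positive {z} 0<z = positive (ℚ.toℚᵘ-cancel-< (ℚᵘ.<-respʳ-≃ (ℚᵘ.≃-sym (toℚᵘ-ι z))
    (ℚᵘ.*<* (subst₂ ℤ._<_ refl (sym (ℤ.*-identityʳ z)) 0<z))))

  sign : Angle → ℤ
  sign π/4  = + 1
  sign 3π/4 = -[1+ 0 ]

  sign-squared : ∀ γ → sign γ ℤ.* sign γ ≡ + 1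
  sign-squared π/4  = refl
  sign-squared 3π/4 = refl

  ι-form : ∀ ε p w → ι (form ε p w) ≡ ι p * ι p + 2ℚ * ι ε * (ι p * ι w) - ι w * ι w
  ι-form ε p w = begin
    ι (p² ℤ.+ 2εpw ℤ.- w²)
      ≡⟨ ι-+ (p² ℤ.+ 2εpw) (ℤ.- w²) ⟩
    ι (p² ℤ.+ 2εpw) + ι (ℤ.- w²)
      ≡⟨ cong₂ _+_ (ι-+ p² 2εpw) (ι-- w²) ⟩
    ι p² + ι 2εpw - ι w²
      ≡⟨ cong₂ (λ x y → x + ι 2εpw - y) (ι-* p p) (ι-* w w) ⟩
    ι p * ι p + ι 2εpw - ι w * ι w
      ≡⟨ cong (λ x → ι p * ι p + x - ι w * ι w)
           (trans (ι-* (+ 2 ℤ.* ε) (p ℤ.* w)) (cong₂ _*_ (ι-* (+ 2) ε) (ι-* p w))) ⟩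
    ι p * ι p + 2ℚ * ι ε * (ι p * ι w) - ι w * ι w ∎
    where
    open ≡-Reasoning
    p² = p ℤ.* p
    w² = w ℤ.* w
    2εpw = + 2 ℤ.* ε ℤ.* (p ℤ.* w)

  -- For k = 1 and ε the sign, a - εb = p² - w². As ε² = 1, this gives a² + 2b² - 2εab = (a - εb)² +
  -- b² = (p² - w²)² + (2pw)² = c². Splitting on the angle turns ε into a constant, so that the
  -- solver can use ε² = 1.
  pythagorean : ∀ γ k p w →
    let a = k * (p * p + 2ℚ * ι (sign γ) * (p * w) - w * w)
        b = k * (2ℚ * (p * w))
        c = k * (p * p + w * w)
    in c * c ≡ oppositeSideSquared γ a b
  pythagorean π/4 = solve 3 (λ k p w →
    let a = k :* (p :* p :+ con 2ℚ :* con 1ℚ :* (p :* w) :- w :* w)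
        b = k :* (con 2ℚ :* (p :* w))
        c = k :* (p :* p :+ w :* w)
    in c :* c := a :* a :+ con 2ℚ :* (b :* b) :- con 2ℚ :* (a :* b)) refl
    where open +-*-Solver
  pythagorean 3π/4 = solve 3 (λ k p w →
    let a = k :* (p :* p :+ con 2ℚ :* con (- 1ℚ) :* (p :* w) :- w :* w)
        b = k :* (con 2ℚ :* (p :* w))
        c = k :* (p :* p :+ w :* w)
    in c :* c := a :* a :+ con 2ℚ :* (b :* b) :+ con 2ℚ :* (a :* b)) refl
    where open +-*-Solver

  triangle : ∀ γ {n d p w} → + 0 ℤ.< d → + 0 ℤ.< p → + 0 ℤ.< w → + 0 ℤ.< form (sign γ) p w →
    p ℤ.* w ℤ.* form (sign γ) p w ≡ + n ℤ.* (d ℤ.* d) → CongruentTriangle γ n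
  triangle γ {n} {d} {p} {w} 0<d 0<p 0<w 0<F pwF≡nd² = record
    { a = k * ι F
    ; b = k * (2ℚ * (ι p * ι w))
    ; c = k * (ι p * ι p + ι w * ι w)
    ; a-positive = ℚ.positive⁻¹ _ {{ℚ.pos*pos⇒pos k (ι F)}}
    ; b-positive = ℚ.positive⁻¹ _ {{ℚ.pos*pos⇒pos k (2ℚ * (ι p * ι w))
        {{ℚ.pos*pos⇒pos 2ℚ (ι p * ι w) {{ℚ.pos*pos⇒pos (ι p) (ι w)}}}}}}
    ; c-positive = ℚ.positive⁻¹ _ {{ℚ.pos*pos⇒pos k (ι p * ι p + ι w * ι w)
        {{ℚ.pos+pos⇒pos (ι p * ι p) {{ℚ.pos*pos⇒pos (ι p) (ι p)}} (ι w * ι w) {{ℚ.pos*pos⇒pos (ι w) (ι w)}}}}}}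
    ; area = begin
        k * ι F * (k * (2ℚ * (ι p * ι w)))      ≡⟨ rearrange k (ι F) (ι p) (ι w) ⟩
        2ℚ * (k * k * (ι p * ι w * ι F))        ≡⟨ cong (λ z → 2ℚ * (k * k * z)) ι-area ⟩
        2ℚ * (k * k * (ι (+ n) * (ι d * ι d)))  ≡⟨ regroup k (ι d) (ι (+ n)) ⟩
        2ℚ * (k * ι d * (k * ι d) * ι (+ n))    ≡⟨ cong (λ z → 2ℚ * (z * z * ι (+ n))) (ℚ.*-inverseˡ (ι d)) ⟩
        2ℚ * (1ℚ * 1ℚ * ι (+ n))                ≡⟨ cong (2ℚ *_) (ℚ.*-identityˡ (ι (+ n))) ⟩
        2ℚ * ι (+ n)                            ∎
    ; law-of-cosines = trans (pythagorean γ k (ι p) (ι w))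
        (cong (λ z → oppositeSideSquared γ (k * z) (k * (2ℚ * (ι p * ι w)))) (sym (ι-form (sign γ) p w)))
    }
    where
    open ≡-Reasoning
    F = form (sign γ) p w
    instance
      ιd-positive : Positive (ι d)
      ιd-positive = ι-positive 0<d
      ιp-positive : Positive (ι p)
      ιp-positive = ι-positive 0<p
      ιw-positive : Positive (ι w)
      ιw-positive = ι-positive 0<w
      ιF-positive : Positive (ι F)
      ιF-positive = ι-positive 0<F
      ιd-nonZero = ℚ.pos⇒nonZero (ι d)
    k : ℚ
    k = 1/ ι d
    instance
      k-positive : Positive k
      k-positive = ℚ.1/pos⇒pos (ι d)
    ι-area : ι p * ι w * ι F ≡ ι (+ n) * (ι d * ι d)
    ι-area = begin
      ι p * ι w * ι F              ≡⟨ cong (_* ι F) (ι-* p w) ⟨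
      ι (p ℤ.* w) * ι F            ≡⟨ ι-* (p ℤ.* w) F ⟨
      ι (p ℤ.* w ℤ.* F)            ≡⟨ cong ι pwF≡nd² ⟩
      ι (+ n ℤ.* (d ℤ.* d))        ≡⟨ ι-* (+ n) (d ℤ.* d) ⟩
      ι (+ n) * ι (d ℤ.* d)        ≡⟨ cong (ι (+ n) *_) (ι-* d d) ⟩
      ι (+ n) * (ι d * ι d)        ∎
    rearrange : ∀ k F P W → k * F * (k * (2ℚ * (P * W))) ≡ 2ℚ * (k * k * (P * W * F))
    rearrange = solve 4 (λ k F P W → k :* F :* (k :* (con 2ℚ :* (P :* W))) := con 2ℚ :* (k :* k :* (P :* W :* F))) refl
      where open +-*-Solver
    regroup : ∀ k D N → 2ℚ * (k * k * (N * (D * D))) ≡ 2ℚ * (k * D * (k * D) * N)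
    regroup = solve 3 (λ k D N → con 2ℚ :* (k :* k :* (N :* (D :* D))) := con 2ℚ :* (k :* D :* (k :* D) :* N)) refl
      where open +-*-Solver

module Sieving where

  open import Data.Integer using (ℤ; +_)
  open import Data.Integer.Divisibility.Signed using (∣⇒∣ᵤ) renaming (_∣_ to _∣ℤ_)
  open import Data.List using (List; []; _∷_; _++_; length; map; upTo; cartesianProduct; cartesianProductWith)
  open import Data.List.Membership.Propositional using (_∈_; lose)
  open import Data.List.Membership.Propositional.Properties
    using (∈-++⁺ˡ; ∈-++⁺ʳ; ∈-map⁺; ∈-upTo⁺; ∈-upTo⁻; ∈-cartesianProductWith⁺; ∈-cartesianProduct⁻)
  open import Data.List.Properties using (length-map; length-++; length-upTo)
  open import Data.List.Relation.Binary.Sublist.Propositional using (_⊆_; []; _∷_; _∷ʳ_)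
  open import Data.List.Relation.Binary.Sublist.Propositional.Properties using (All-resp-⊆)
  open import Data.List.Relation.Unary.All as All using (All; []; _∷_)
  open import Data.List.Relation.Unary.AllPairs using ([]; _∷_)
  open import Data.List.Relation.Unary.Any using (Any; toSum)
  open import Data.List.Relation.Unary.Unique.Propositional using (Unique)
  import Data.List.Relation.Unary.Unique.Propositional.Properties as Unique
  open import Data.Nat
  open import Data.Nat.Coprimality using (Coprime; coprime-Bézout; coprime-divisor; coprime-/gcd)
  open import Data.Nat.Divisibility
  open import Data.Nat.DivMod
  open import Data.Nat.GCD using (gcd; gcd[m,n]∣m; gcd[m,n]∣n; gcd-greatest; gcd[m,n]≢0; module Bézout)
  open import Data.Nat.ListAction using (product)
  open import Data.Nat.Primality
  open import Data.Nat.Primality.Factorisation using (factorise)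
  open import Data.Nat.Properties
  open import Data.Nat.Tactic.RingSolver using (solve-∀)
  open import Relation.Nullary.Decidable using (decidable-stable; _×-dec_; ¬?)
  open BinaryForm
  open Triangle

  -- Finite lists and a pigeonhole principle.

  Unique-resp-⊆ : ∀ {A : Set} {xs ys : List A} → xs ⊆ ys → Unique ys → Unique xs
  Unique-resp-⊆ []          []             = []
  Unique-resp-⊆ (_ ∷ʳ τ)    (_ ∷ unique)   = Unique-resp-⊆ τ unique
  Unique-resp-⊆ (refl ∷ τ)  (x∉ ∷ unique)  = All-resp-⊆ τ x∉ ∷ Unique-resp-⊆ τ unique

  split-⊎ : ∀ {A : Set} {P Q : A → Set} {xs} → All (λ x → P x ⊎ Q x) xs →
    ∃₂ λ ys zs → ys ⊆ xs × zs ⊆ xs × All P ys × All Q zs × length xs ≡ length ys + length zs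
  split-⊎ [] = [] , [] , [] , [] , [] , [] , refl
  split-⊎ (_∷_ {x} pq pqs) with split-⊎ pqs
  ... | ys , zs , ys⊆ , zs⊆ , ps , qs , eq with pq
  ...   | inj₁ p = x ∷ ys , zs , refl ∷ ys⊆ , x ∷ʳ zs⊆ , p ∷ ps , qs , cong suc eq
  ...   | inj₂ q = ys , x ∷ zs , x ∷ʳ ys⊆ , refl ∷ zs⊆ , ps , q ∷ qs ,
                   trans (cong suc eq) (sym (+-suc (length ys) (length zs)))

  first-or-all : ∀ {A : Set} {P Q : A → Set} {xs} → All (λ x → P x ⊎ Q x) xs → ∃ P ⊎ All Q xs
  first-or-all [] = inj₂ []
  first-or-all (inj₁ p ∷ _) = inj₁ (_ , p)
  first-or-all (inj₂ q ∷ pqs) = Sum.map₂ (q ∷_) (first-or-all pqs)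

  -- Induction on the keys: the elements assigned to κ form a duplicate-free sublist, of length at
  -- most 2 by the hypothesis; the others are hit by the remaining keys.
  pigeonhole₂ : ∀ {A K : Set} {Hit : K → A → Set} →
    (∀ {κ x y z} → Hit κ x → Hit κ y → Hit κ z → x ≡ y ⊎ x ≡ z ⊎ y ≡ z) →
    ∀ κs {xs} → Unique xs → All (λ x → Any (λ κ → Hit κ x) κs) xs → length xs ≤ length κs * 2
  pigeonhole₂ ≤2 [] unique [] = z≤n
  pigeonhole₂ {Hit = Hit} ≤2 (κ ∷ κs) unique hits with split-⊎ (All.map toSum hits)
  ... | ys , zs , ys⊆ , zs⊆ , ps , qs , eq = begin
    _                     ≡⟨ eq ⟩
    length ys + length zs ≤⟨ +-mono-≤ (length≤2 (Unique-resp-⊆ ys⊆ unique) ps)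
                               (pigeonhole₂ ≤2 κs (Unique-resp-⊆ zs⊆ unique) qs) ⟩
    2 + length κs * 2     ∎
    where
    open ≤-Reasoning
    length≤2 : ∀ {ys} → Unique ys → All (Hit κ) ys → length ys ≤ 2
    length≤2 [] _ = z≤n
    length≤2 (_ ∷ []) _ = s≤s z≤n
    length≤2 (_ ∷ _ ∷ []) _ = s≤s (s≤s z≤n)
    length≤2 ((x≢y ∷ x≢z ∷ _) ∷ (y≢z ∷ _) ∷ _) (hx ∷ hy ∷ hz ∷ _) =
      contradiction (≤2 hx hy hz) [ x≢y , [ x≢z , y≢z ]′ ]′

  length-cartesianProductWith : ∀ {A B C : Set} (f : A → B → C) xs ys →
    length (cartesianProductWith f xs ys) ≡ length xs * length ys
  length-cartesianProductWith f [] ys = refl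
  length-cartesianProductWith f (x ∷ xs) ys = trans (length-++ (map (f x) ys))
    (cong₂ _+_ (length-map (f x) ys) (length-cartesianProductWith f xs ys))

  square-cancel-≤ : ∀ {m n} → m * m ≤ n * n → m ≤ n
  square-cancel-≤ m²≤n² = ≮⇒≥ λ n<m → <⇒≱ (*-mono-< n<m n<m) m²≤n²

  -- 1/(k+1)² ≤ 1/k - 1/(k+1)
  telescope : ∀ R k .{{_ : NonZero k}} → R / (suc k * suc k) + R / suc k ≤ R / k
  telescope R k = subst (_≤ R / k) (m*n/n≡m _ k) (/-monoˡ-≤ k (*-cancelʳ-≤ _ R (suc k * suc k) (begin
    (q₁ + q₂) * k * (suc k * suc k)                             ≡⟨ expand q₁ q₂ k ⟩
    q₁ * (suc k * suc k) * k + q₂ * suc k * (k * suc k)         ≤⟨ +-mono-≤ (*-monoˡ-≤ k (m/n*n≤m R (suc k * suc k)))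
                                                                       (*-monoˡ-≤ (k * suc k) (m/n*n≤m R (suc k))) ⟩
    R * k + R * (k * suc k)                                     ≤⟨ m≤n+m _ R ⟩
    R + (R * k + R * (k * suc k))                               ≡⟨ collect R k ⟩
    R * (suc k * suc k)                                         ∎)))
    where
    open ≤-Reasoning
    q₁ = R / (suc k * suc k)
    q₂ = R / suc k
    expand : ∀ a b k → (a + b) * k * ((1 + k) * (1 + k)) ≡ a * ((1 + k) * (1 + k)) * k + b * (1 + k) * (k * (1 + k))
    expand = solve-∀
    collect : ∀ R k → R + (R * k + R * (k * (1 + k))) ≡ R * ((1 + k) * (1 + k))
    collect = solve-∀

  -- Counting the keys that belong to small moduli.

  module _ {K : Set} (key : ℕ → ℕ → ℕ → K) (l H R : ℕ) where

    -- Here ℓ runs from `l + 2` to `l + 1 + d`, with one key for each i < H and each block of ℓ²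
    -- consecutive integers starting at or below R. Composite ℓ are listed too: the sum of all 1/ℓ²
    -- is already small enough.
    blockKeys : ℕ → List K
    blockKeys zero    = []
    blockKeys (suc d) = cartesianProductWith (key ℓ) (upTo H) (upTo (suc (R / (ℓ * ℓ)))) ++ blockKeys d
      where ℓ = suc (suc l + d)

    ∈-blockKeys : ∀ {ℓ i b} d → suc l < ℓ → ℓ ≤ suc l + d → i < H → b * (ℓ * ℓ) ≤ R → key ℓ i b ∈ blockKeys d
    ∈-blockKeys {ℓ} zero l<ℓ ℓ≤l _ _ = contradiction (subst (ℓ ≤_) (+-identityʳ (suc l)) ℓ≤l) (<⇒≱ l<ℓ)
    ∈-blockKeys {ℓ} {i} {b} (suc d) l<ℓ ℓ≤ i<H bℓ²≤R with m≤n⇒m<n∨m≡n (subst (ℓ ≤_) (+-suc (suc l) d) ℓ≤)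
    ... | inj₁ (s≤s ℓ≤l+d) = ∈-++⁺ʳ _ (∈-blockKeys d l<ℓ ℓ≤l+d i<H bℓ²≤R)
    ... | inj₂ refl = ∈-++⁺ˡ (∈-cartesianProductWith⁺ (key ℓ) (∈-upTo⁺ i<H)
            (∈-upTo⁺ (s≤s (subst (_≤ R / (ℓ * ℓ)) (m*n/n≡m b (ℓ * ℓ)) (/-monoˡ-≤ (ℓ * ℓ) bℓ²≤R)))))

    length-blockKeys : ∀ d → length (blockKeys d) ≤ H * (R / suc l + d)
    length-blockKeys d = ≤-trans (m≤m+n _ _) (subst (length (blockKeys d) + H * (R / (suc l + d)) ≤_)
      (sym (*-distribˡ-+ H _ d)) (bound d))
      where
      open ≤-Reasoning
      rearrange : ∀ H a b n → H * (1 + a) + n + H * b ≡ n + H * (a + b) + H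
      rearrange = solve-∀
      -- The summand `H * (R / (suc l + d))` is what remains of the telescoping sum; each induction
      -- step spends part of it on the next ℓ.
      bound : ∀ d → length (blockKeys d) + H * (R / (suc l + d)) ≤ H * (R / suc l) + H * d
      bound zero = ≤-trans (*-monoʳ-≤ H (/-monoʳ-≤ R (m≤m+n (suc l) 0))) (m≤m+n _ _)
      bound (suc d) = begin
        length (blockKeys (suc d)) + H * (R / (suc l + suc d))
          ≡⟨ cong₂ (λ n q → n + H * q) (trans (length-++ (cartesianProductWith (key ℓ) (upTo H) _))
               (cong (_+ length (blockKeys d)) (trans (length-cartesianProductWith (key ℓ) (upTo H) _)
                 (cong₂ _*_ (length-upTo H) (length-upTo _))))) (/-congʳ {m = R} (+-suc (suc l) d)) ⟩
        H * suc (R / (ℓ * ℓ)) + length (blockKeys d) + H * (R / ℓ)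
          ≡⟨ rearrange H (R / (ℓ * ℓ)) (R / ℓ) (length (blockKeys d)) ⟩
        length (blockKeys d) + H * (R / (ℓ * ℓ) + R / ℓ) + H
          ≤⟨ +-monoˡ-≤ H (+-monoʳ-≤ (length (blockKeys d)) (*-monoʳ-≤ H (telescope R (suc l + d)))) ⟩
        length (blockKeys d) + H * (R / (suc l + d)) + H
          ≤⟨ +-monoˡ-≤ H (bound d) ⟩
        H * (R / suc l) + H * d + H
          ≡⟨ +-assoc _ (H * d) H ⟩
        H * (R / suc l) + (H * d + H)
          ≡⟨ cong (_+_ (H * (R / suc l))) (trans (+-comm (H * d) H) (sym (*-suc H d))) ⟩
        H * (R / suc l) + H * suc d ∎
        where ℓ = suc (suc l + d)

  -- Prime divisors, coprimality and arithmetic progressions.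

  prime-divisor : ∀ n .{{_ : NonZero n}} → n ≢ 1 → ∃ λ ℓ → Prime ℓ × ℓ ∣ n
  prime-divisor n n≢1 with factorise n
  ... | record { factors = [] ; isFactorisation = n≡1 } = contradiction n≡1 n≢1
  ... | record { factors = ℓ ∷ ℓs ; isFactorisation = n≡ ; factorsPrime = ℓ-prime ∷ _ } =
    ℓ , ℓ-prime , subst (ℓ ∣_) (sym n≡) (m∣m*n (product ℓs))

  prime-square-divisor : ∀ n .{{_ : NonZero n}} → SquareFree n ⊎ ∃ λ ℓ → Prime ℓ × ℓ * ℓ ∣ n
  prime-square-divisor n with anyUpTo? (λ d → (d * d ∣? n) ×-dec ¬? (d ≟ 1)) (suc n)
  ... | no none = inj₁ λ d d²∣n → decidable-stable (d ≟ 1) λ d≢1 →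
          none (d , s≤s (∣⇒≤ (∣-trans (m∣m*n d) d²∣n)) , d²∣n , d≢1)
  ... | yes (zero , _ , 0∣n , _) = contradiction (0∣⇒≡0 0∣n) (≢-nonZero⁻¹ n)
  ... | yes (d@(suc _) , _ , d²∣n , d≢1) with prime-divisor d d≢1
  ...   | ℓ , ℓ-prime , ℓ∣d = inj₂ (ℓ , ℓ-prime , ∣-trans (*-pres-∣ ℓ∣d ℓ∣d) d²∣n)

  ∣m+n∣n⇒∣m : ∀ {d m n} → d ∣ m + n → d ∣ n → d ∣ m
  ∣m+n∣n⇒∣m {d} {m} {n} d∣m+n = ∣m+n∣m⇒∣n (subst (d ∣_) (+-comm m n) d∣m+n)

  NoCommonPrime : ℕ → ℕ → Set
  NoCommonPrime m n = ∀ {ℓ} → Prime ℓ → ℓ ∣ m → ¬ ℓ ∣ n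

  noCommonPrime⇒coprime : ∀ {m n} .{{_ : NonZero n}} → NoCommonPrime m n → Coprime m n
  noCommonPrime⇒coprime {n = n} none {zero} (_ , 0∣n) = contradiction (0∣⇒≡0 0∣n) (≢-nonZero⁻¹ n)
  noCommonPrime⇒coprime none {d@(suc _)} (d∣m , d∣n) = decidable-stable (d ≟ 1) λ d≢1 →
    let ℓ , ℓ-prime , ℓ∣d = prime-divisor d d≢1
    in none ℓ-prime (∣-trans ℓ∣d d∣m) (∣-trans ℓ∣d d∣n)

  coprime⇒noCommonPrime : ∀ {m n} → Coprime m n → NoCommonPrime m n
  coprime⇒noCommonPrime coprime ℓ-prime ℓ∣m ℓ∣n =
    ¬prime[1] (subst Prime (coprime (ℓ∣m , ℓ∣n)) ℓ-prime)

  prime∣prime : ∀ {p q} → Prime p → Prime q → p ∣ q → p ≡ q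
  prime∣prime p-prime q-prime p∣q with prime⇒irreducible q-prime p∣q
  ... | inj₁ refl = contradiction p-prime ¬prime[1]
  ... | inj₂ p≡q  = p≡q

  -- The prime factors p of s are treated one at a time. If p divides the current term, adding
  -- `v * Q`, with Q the product of the primes already treated, repairs p without spoiling those.
  coprime-in-progression : ∀ {u v} → Coprime u v → ∀ s .{{_ : NonZero s}} →
    ∃ λ t → NoCommonPrime (u + v * t) s
  coprime-in-progression {u} {v} coprime s with factorise s
  ... | record { factors = ps ; isFactorisation = refl ; factorsPrime = ps-prime } = go ps-prime
    where
    go : ∀ {ps} → All Prime ps → ∃ λ t → NoCommonPrime (u + v * t) (product ps)
    go [] = 0 , λ ℓ-prime _ ℓ∣1 → ¬prime[1] (subst Prime (∣1⇒≡1 ℓ∣1) ℓ-prime)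
    go {p ∷ ps} (p-prime ∷ ps-prime) with go ps-prime
    ... | t , none with p ∣? u + v * t
    ...   | no p∤ = t , none′
      where
      none′ : NoCommonPrime (u + v * t) (p * product ps)
      none′ ℓ-prime ℓ∣ ℓ∣pQ with euclidsLemma p _ ℓ-prime ℓ∣pQ
      ... | inj₂ ℓ∣Q = none ℓ-prime ℓ∣ ℓ∣Q
      ... | inj₁ ℓ∣p with refl ← prime∣prime ℓ-prime p-prime ℓ∣p = p∤ ℓ∣
    ...   | yes p∣ = t + Q , none′
      where
      Q = product ps
      shift : u + v * (t + Q) ≡ (u + v * t) + v * Q
      shift = trans (cong (_+_ u) (*-distribˡ-+ v t Q)) (sym (+-assoc u (v * t) (v * Q)))
      none′ : NoCommonPrime (u + v * (t + Q)) (p * Q)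
      none′ {ℓ} ℓ-prime ℓ∣ ℓ∣pQ with euclidsLemma p Q ℓ-prime ℓ∣pQ
      ... | inj₂ ℓ∣Q = none ℓ-prime (∣m+n∣n⇒∣m (subst (ℓ ∣_) shift ℓ∣) (∣n⇒∣m*n v ℓ∣Q)) ℓ∣Q
      -- Now p divides the old and the new term, hence `v * Q`. If p ∣ v, then also p ∣ u, against
      -- coprimality; p ∣ Q contradicts the choice of t.
      ... | inj₁ ℓ∣p with refl ← prime∣prime ℓ-prime p-prime ℓ∣p
          with euclidsLemma v Q ℓ-prime (∣m+n∣m⇒∣n (subst (ℓ ∣_) shift ℓ∣) p∣)
      ...   | inj₁ p∣v = coprime⇒noCommonPrime coprime ℓ-prime (∣m+n∣n⇒∣m p∣ (∣m⇒∣m*n t p∣v)) p∣v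
      ...   | inj₂ p∣Q = none ℓ-prime p∣ p∣Q

  -- Whichever sign Bézout's identity x u ≡ ±1 has, (x u)² ≡ 1.
  inverse : ∀ {u s} → Coprime u s → ∃ λ y → + s ∣ℤ + u ℤ.* + y ℤ.- + 1
  inverse {u} {s} coprime = invert (coprime-Bézout coprime)
    where
    difference-of-squares : ∀ u x → (x ℤ.* u ℤ.- + 1) ℤ.* (x ℤ.* u ℤ.+ + 1) ≡ u ℤ.* (x ℤ.* x ℤ.* u) ℤ.- + 1
    difference-of-squares = ℤ-Solver.solve-∀
    cast : ∀ x → (+ x ℤ.* + u ℤ.- + 1) ℤ.* (+ x ℤ.* + u ℤ.+ + 1) ≡ + u ℤ.* + (x * x * u) ℤ.- + 1
    cast x = trans (difference-of-squares (+ u) (+ x)) (cong (λ z → + u ℤ.* z ℤ.- + 1)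
      (sym (trans (ℤ.pos-* (x * x) u) (cong (ℤ._* + u) (ℤ.pos-* x x)))))
    cancel-1 : ∀ z → z ≡ (+ 1 ℤ.+ z) ℤ.- + 1
    cancel-1 = ℤ-Solver.solve-∀
    invert : Bézout.Identity 1 u s → ∃ λ y → + s ∣ℤ + u ℤ.* + y ℤ.- + 1
    invert (Bézout.+- x y eq) = x * x * u , subst (+ s ∣ℤ_) (cast x) (ℤ.∣m⇒∣m*n _ (ℤ.divides (+ y) (sym (begin
      + y ℤ.* + s                ≡⟨ ℤ.pos-* y s ⟨
      + (y * s)                  ≡⟨ cancel-1 (+ (y * s)) ⟩
      + (1 + y * s) ℤ.- + 1      ≡⟨ cong (λ z → + z ℤ.- + 1) eq ⟩
      + (x * u) ℤ.- + 1          ≡⟨ cong (ℤ._- + 1) (ℤ.pos-* x u) ⟩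
      + x ℤ.* + u ℤ.- + 1        ∎))))
      where open ≡-Reasoning
    invert (Bézout.-+ x y eq) = x * x * u , subst (+ s ∣ℤ_) (cast x) (ℤ.∣n⇒∣m*n (+ x ℤ.* + u ℤ.- + 1) (ℤ.divides (+ y) (begin
      + x ℤ.* + u ℤ.+ + 1        ≡⟨ ℤ.+-comm (+ x ℤ.* + u) (+ 1) ⟩
      + 1 ℤ.+ + x ℤ.* + u        ≡⟨ cong (ℤ._+_ (+ 1)) (ℤ.pos-* x u) ⟨
      + (1 + x * u)              ≡⟨ cong +_ eq ⟩
      + (y * s)                  ≡⟨ ℤ.pos-* y s ⟩
      + y ℤ.* + s                ∎)))
      where open ≡-Reasoning

  close-multiples : ∀ {d m n} → + d ∣ℤ + m ℤ.- + n → m < n + d → n < m + d → m ≡ n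
  close-multiples {d} {m} {n} d∣m-n m<n+d n<m+d =
    [ ordered n<m+d d∣∣m⊖n∣
    , (λ n≤m → sym (ordered m<n+d (subst (d ∣_) (ℤ.∣m⊖n∣≡∣n⊖m∣ m n) d∣∣m⊖n∣) n≤m))
    ]′ (≤-total m n)
    where
    d∣∣m⊖n∣ : d ∣ ℤ.∣ m ℤ.⊖ n ∣
    d∣∣m⊖n∣ = subst (λ z → d ∣ ℤ.∣ z ∣) (ℤ.m-n≡m⊖n m n) (∣⇒∣ᵤ d∣m-n)
    ordered : ∀ {m n} → n < m + d → d ∣ ℤ.∣ m ℤ.⊖ n ∣ → m ≤ n → m ≡ n
    ordered {m} {n} n<m+d d∣ m≤n with n ∸ m in eq | subst (d ∣_) (ℤ.∣⊖∣-≤ m≤n) d∣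
    ... | zero  | _   = ≤-antisym m≤n (m∸n≡0⇒m≤n eq)
    ... | suc k | d∣k = contradiction (∣⇒≤ d∣k) (<⇒≱ (subst (_< d) eq n∸m<d))
      where
      n∸m<d : n ∸ m < d
      n∸m<d = +-cancelˡ-< m (n ∸ m) d (subst (_< m + d) (sym (m+[n∸m]≡n m≤n)) n<m+d)

  -- Substituting p = 3w + r makes every coefficient of the form nonnegative.
  form-value : ∀ γ {p w} → 3 * w ≤ p → 0 < w → ∃ λ f → form (sign γ) (+ p) (+ w) ≡ + f × 0 < f × f ≤ 2 * p * (2 * p)
  form-value γ {p} {w} 3w≤p 0<w with r , refl ← m≤n⇒∃[o]m+o≡n 3w≤p = value γ
    where
    instance
      w-nonZero : NonZero w
      w-nonZero = >-nonZero 0<w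
      w²-nonZero = m*n≢0 w w
    cast-p : + (3 * w + r) ≡ + 3 ℤ.* + w ℤ.+ + r
    cast-p = trans (ℤ.pos-+ (3 * w) r) (cong (ℤ._+ + r) (ℤ.pos-* 3 w))
    cast-value : ∀ a b → + (a * (w * w) + b * (w * r) + r * r) ≡ + a ℤ.* (+ w ℤ.* + w) ℤ.+ + b ℤ.* (+ w ℤ.* + r) ℤ.+ + r ℤ.* + r
    cast-value a b = trans (ℤ.pos-+ (a * (w * w) + b * (w * r)) (r * r)) (cong₂ ℤ._+_
      (trans (ℤ.pos-+ (a * (w * w)) (b * (w * r))) (cong₂ ℤ._+_
        (trans (ℤ.pos-* a (w * w)) (cong (ℤ._*_ (+ a)) (ℤ.pos-* w w)))
        (trans (ℤ.pos-* b (w * r)) (cong (ℤ._*_ (+ b)) (ℤ.pos-* w r))))) (ℤ.pos-* r r))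
    positive : ∀ a b .{{_ : NonZero a}} → 0 < a * (w * w) + b * (w * r) + r * r
    positive a b = ≤-trans (>-nonZero⁻¹ (a * (w * w)) {{m*n≢0 a (w * w)}})
      (≤-trans (m≤m+n _ (b * (w * r))) (m≤m+n _ (r * r)))
    value : ∀ γ → ∃ λ f → form (sign γ) (+ (3 * w + r)) (+ w) ≡ + f × 0 < f × f ≤ 2 * (3 * w + r) * (2 * (3 * w + r))
    value π/4 = 14 * (w * w) + 8 * (w * r) + r * r ,
      trans (cong (λ p → form (+ 1) p (+ w)) cast-p) (trans (identity (+ w) (+ r)) (sym (cast-value 14 8))) ,
      positive 14 8 ,
      m+n≤o⇒m≤o _ (≤-reflexive (bound w r))
      where
      identity : ∀ w r → let p = + 3 ℤ.* w ℤ.+ r in p ℤ.* p ℤ.+ + 2 ℤ.* + 1 ℤ.* (p ℤ.* w) ℤ.- w ℤ.* w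
        ≡ + 14 ℤ.* (w ℤ.* w) ℤ.+ + 8 ℤ.* (w ℤ.* r) ℤ.+ r ℤ.* r
      identity = ℤ-Solver.solve-∀
      -- The last summand is (2p)² - F, written with nonnegative coefficients. Hence ℓ² ∣ F forces ℓ
      -- ≤ 2p.
      bound : ∀ w r → 14 * (w * w) + 8 * (w * r) + r * r + (22 * (w * w) + 16 * (w * r) + 3 * (r * r)) ≡ 2 * (3 * w + r) * (2 * (3 * w + r))
      bound = solve-∀
    value 3π/4 = 2 * (w * w) + 4 * (w * r) + r * r ,
      trans (cong (λ p → form (ℤ.- + 1) p (+ w)) cast-p) (trans (identity (+ w) (+ r)) (sym (cast-value 2 4))) ,
      positive 2 4 ,
      m+n≤o⇒m≤o _ (≤-reflexive (bound w r))
      where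
      identity : ∀ w r → let p = + 3 ℤ.* w ℤ.+ r in p ℤ.* p ℤ.+ + 2 ℤ.* ℤ.- + 1 ℤ.* (p ℤ.* w) ℤ.- w ℤ.* w
        ≡ + 2 ℤ.* (w ℤ.* w) ℤ.+ + 4 ℤ.* (w ℤ.* r) ℤ.+ r ℤ.* r
      identity = ℤ-Solver.solve-∀
      bound : ∀ w r → 2 * (w * w) + 4 * (w * r) + r * r + (34 * (w * w) + 20 * (w * r) + 3 * (r * r)) ≡ 2 * (3 * w + r) * (2 * (3 * w + r))
      bound = solve-∀

  prime∣^⇒∣ : ∀ {ℓ} → Prime ℓ → ∀ s k → ℓ ∣ s ^ k → ℓ ∣ s
  prime∣^⇒∣ ℓ-prime s zero    ℓ∣1 = contradiction (subst Prime (∣1⇒≡1 ℓ∣1) ℓ-prime) ¬prime[1]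
  prime∣^⇒∣ ℓ-prime s (suc k) ℓ∣s^ with euclidsLemma s (s ^ k) ℓ-prime ℓ∣s^
  ... | inj₁ ℓ∣s  = ℓ∣s
  ... | inj₂ ℓ∣s^k = prime∣^⇒∣ ℓ-prime s k ℓ∣s^k

  -- The grid of pairs (i , j) and its congruences modulo s.

  module Grid (γ : Angle) (u g s y : ℕ) .{{_ : NonZero u}} .{{_ : NonZero g}} (1<s : 1 < s)
    (g∣s : g ∣ s) (u⊥s : NoCommonPrime u s) (uy≡1 : + s ∣ℤ + u ℤ.* + y ℤ.- + 1) where

    private instance
      s-nonZero : NonZero s
      s-nonZero = >-nonZero (<-trans z<s 1<s)

    ε : ℤ
    ε = sign γ

    -- The exponent `suc i` makes s divide every `w i`. The product `p j * w i` is `g * x j` times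
    -- the square of `u * t i`, and this square is what the scaling of the triangle removes.
    t w : ℕ → ℕ
    t i = s ^ suc i
    w i = g * (t i * t i)

    x p : ℕ → ℕ
    x j = y + s * j
    p j = u * u * x j

    F : ℕ → ℕ → ℤ
    F i j = form ε (+ p j) (+ w i)

    w-mono-< : ∀ {i i′} → i < i′ → w i < w i′
    w-mono-< i<i′ = *-monoʳ-< g (*-mono-< t< t<)
      where t< = ^-monoʳ-< s 1<s (s≤s i<i′)

    w-mono-≤ : ∀ {i i′} → i ≤ i′ → w i ≤ w i′
    w-mono-≤ i≤i′ = *-monoʳ-≤ g (*-mono-≤ t≤ t≤)
      where t≤ = ^-monoʳ-≤ s (s≤s i≤i′)

    w-injective : ∀ {i i′} → w i ≡ w i′ → i ≡ i′
    w-injective {i} {i′} eq with <-cmp i i′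
    ... | tri< i<i′ _ _ = contradiction eq (<⇒≢ (w-mono-< i<i′))
    ... | tri≈ _ i≡i′ _ = i≡i′
    ... | tri> _ _ i>i′ = contradiction (sym eq) (<⇒≢ (w-mono-< i>i′))

    0<t : ∀ i → 0 < t i
    0<t i = m^n>0 s (suc i)

    0<w : ∀ i → 0 < w i
    0<w i = *-mono-≤ (>-nonZero⁻¹ g) (*-mono-≤ (0<t i) (0<t i))

    private instance
      u²-nonZero : NonZero (u * u)
      u²-nonZero = m*n≢0 u u

    y≤x : ∀ j → y ≤ x j
    y≤x j = m≤m+n y (s * j)

    x≤p : ∀ j → x j ≤ p j
    x≤p j = m≤n*m (x j) (u * u)

    p-injective : ∀ {j j′} → p j ≡ p j′ → j ≡ j′
    p-injective {j} {j′} eq = *-cancelˡ-≡ j j′ s (+-cancelˡ-≡ y (s * j) (s * j′) (*-cancelˡ-≡ (x j) (x j′) (u * u) eq))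

    s∣w : ∀ i → s ∣ w i
    s∣w i = ∣n⇒∣m*n g (∣m⇒∣m*n (t i) (m∣m*n (s ^ i)))

    +x≡ : ∀ j → + x j ≡ + y ℤ.+ + s ℤ.* + j
    +x≡ j = trans (ℤ.pos-+ y (s * j)) (cong (ℤ._+_ (+ y)) (ℤ.pos-* s j))

    ux≡1 : ∀ j → + s ∣ℤ + u ℤ.* + x j ℤ.- + 1
    ux≡1 j = subst (+ s ∣ℤ_)
      (trans (identity (+ u) (+ y) (+ s) (+ j)) (cong (λ z → + u ℤ.* z ℤ.- + 1) (sym (+x≡ j))))
      (ℤ.∣m∣n⇒∣m+n uy≡1 (ℤ.∣m⇒∣m*n (+ u ℤ.* + j) ℤ.∣-refl))
      where
      identity : ∀ u y s j → (u ℤ.* y ℤ.- + 1) ℤ.+ s ℤ.* (u ℤ.* j) ≡ u ℤ.* (y ℤ.+ s ℤ.* j) ℤ.- + 1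
      identity = ℤ-Solver.solve-∀

    +p≡ : ∀ j → + p j ≡ + u ℤ.* + u ℤ.* + x j
    +p≡ j = trans (ℤ.pos-* (u * u) (x j)) (cong (ℤ._* + x j) (ℤ.pos-* u u))

    -- With s ∣ w and u x ≡ 1 we get x F ≡ x p² = (u x)³ u ≡ u.
    xF≡u : ∀ i j → + s ∣ℤ + x j ℤ.* F i j ℤ.- + u
    xF≡u i j = subst (+ s ∣ℤ_)
      (trans (identity ε (+ u) (+ x j) (+ w i)) (cong (λ p → + x j ℤ.* form ε p (+ w i) ℤ.- + u) (sym (+p≡ j))))
      (ℤ.∣m∣n⇒∣m+n (ℤ.∣m⇒∣m*n _ (ux≡1 j)) (ℤ.∣m⇒∣m*n _ (∣⇒+∣+ (s∣w i))))
      where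
      identity : ∀ e u x w → let p = u ℤ.* u ℤ.* x; z = u ℤ.* x in
        (z ℤ.- + 1) ℤ.* ((z ℤ.* z ℤ.+ z ℤ.+ + 1) ℤ.* u) ℤ.+ w ℤ.* (x ℤ.* (+ 2 ℤ.* e ℤ.* p ℤ.- w))
          ≡ x ℤ.* (p ℤ.* p ℤ.+ + 2 ℤ.* e ℤ.* (p ℤ.* w) ℤ.- w ℤ.* w) ℤ.- u
      identity = ℤ-Solver.solve-∀

    module _ {ℓ} (ℓ-prime : Prime ℓ) where

      -- Since x F ≡ u modulo s, a common prime of x F and s would divide u, which is prime to s.
      ∣xF⇒∤s : ∀ {i j} → + ℓ ∣ℤ + x j ℤ.* F i j → ¬ ℓ ∣ s
      ∣xF⇒∤s {i} {j} ℓ∣xF ℓ∣s = u⊥s ℓ-prime (∣⇒∣ᵤ {i = + u} ℓ∣u) ℓ∣s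
        where
        cancel : ∀ a b → a ℤ.- (a ℤ.- b) ≡ b
        cancel = ℤ-Solver.solve-∀
        ℓ∣u : + ℓ ∣ℤ + u
        ℓ∣u = subst (+ ℓ ∣ℤ_) (cancel (+ x j ℤ.* F i j) (+ u))
          (ℤ.∣m∣n⇒∣m-n ℓ∣xF (ℤ.∣-trans (∣⇒+∣+ ℓ∣s) (xF≡u i j)))

      ∣x⇒∤s : ∀ {j} → ℓ ∣ x j → ¬ ℓ ∣ s
      ∣x⇒∤s {j} ℓ∣x = ∣xF⇒∤s {0} {j} (ℤ.∣m⇒∣m*n (F 0 j) (∣⇒+∣+ ℓ∣x))

      ∣F⇒∤s : ∀ {i j} → + ℓ ∣ℤ F i j → ¬ ℓ ∣ s
      ∣F⇒∤s {i} {j} ℓ∣F = ∣xF⇒∤s {i} {j} (ℤ.∣n⇒∣m*n (+ x j) ℓ∣F)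

      ∣w⇒∣s : ∀ {i} → ℓ ∣ w i → ℓ ∣ s
      ∣w⇒∣s {i} ℓ∣w with euclidsLemma g (t i * t i) ℓ-prime ℓ∣w
      ... | inj₁ ℓ∣g = ∣-trans ℓ∣g g∣s
      ... | inj₂ ℓ∣t² = prime∣^⇒∣ ℓ-prime s (suc i) (Sum.reduce (euclidsLemma (t i) (t i) ℓ-prime ℓ∣t²))

      ∣p⇒∤s : ∀ {j} → ℓ ∣ p j → ¬ ℓ ∣ s
      ∣p⇒∤s {j} ℓ∣p with euclidsLemma (u * u) (x j) ℓ-prime ℓ∣p
      ... | inj₂ ℓ∣x = ∣x⇒∤s ℓ∣x
      ... | inj₁ ℓ∣u² = u⊥s ℓ-prime (Sum.reduce (euclidsLemma u u ℓ-prime ℓ∣u²))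

      -- A prime dividing p and F divides w², hence s, because every prime of w divides s; but no
      -- prime of F does.
      ∣F⇒∤p : ∀ {i j} → + ℓ ∣ℤ F i j → ¬ ℓ ∣ p j
      ∣F⇒∤p {i} {j} ℓ∣F ℓ∣p = ∣F⇒∤s {i} {j} ℓ∣F (∣w⇒∣s {i} ([ ∣⇒∣ᵤ , ∣⇒∣ᵤ ]′ (euclid (+ w i) (+ w i) ℓ-prime ℓ∣w²)))
        where
        identity : ∀ e p w → p ℤ.* (p ℤ.+ + 2 ℤ.* e ℤ.* w) ℤ.- (p ℤ.* p ℤ.+ + 2 ℤ.* e ℤ.* (p ℤ.* w) ℤ.- w ℤ.* w) ≡ w ℤ.* w
        identity = ℤ-Solver.solve-∀
        ℓ∣w² : + ℓ ∣ℤ + w i ℤ.* + w i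
        ℓ∣w² = subst (+ ℓ ∣ℤ_) (identity ε (+ p j) (+ w i)) (ℤ.∣m∣n⇒∣m-n (ℤ.∣m⇒∣m*n _ (∣⇒+∣+ ℓ∣p)) ℓ∣F)

    p⊥w : ∀ i j → Coprime (p j) (w i)
    p⊥w i j = noCommonPrime⇒coprime {{>-nonZero (0<w i)}}
      λ ℓ-prime ℓ∣p ℓ∣w → ∣p⇒∤s ℓ-prime {j} ℓ∣p (∣w⇒∣s ℓ-prime {i} ℓ∣w)

    -- Pairs excluded by one and the same prime square.

    module _ .{{_ : NonZero y}} where

      private
        p-nonZero : ∀ j → NonZero (p j)
        p-nonZero j = m*n≢0 (u * u) (x j) {{u²-nonZero}} {{>-nonZero (≤-trans (>-nonZero⁻¹ y) (y≤x j))}}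

      -- The fractions p/w are in lowest terms, so equal ones have the same numerator and
      -- denominator, and these determine j and i.
      proportional⇒equal : ∀ {i j i′ j′} → p j * w i′ ≡ p j′ * w i → i ≡ i′ × j ≡ j′
      proportional⇒equal {i} {j} {i′} {j′} eq = w-injective (sym w≡) , p-injective {j} {j′} p≡
        where
        ∣ˡ : ∀ {i j i′ j′} → p j * w i′ ≡ p j′ * w i → p j ∣ p j′
        ∣ˡ {i} {j} {i′} {j′} eq = coprime-divisor (p⊥w i j)
          (divides (w i′) (trans (*-comm (w i) (p j′)) (trans (sym eq) (*-comm (p j) (w i′)))))
        p≡ : p j ≡ p j′
        p≡ = ∣-antisym (∣ˡ {i} {j} {i′} {j′} eq) (∣ˡ {i′} {j′} {i} {j} (sym eq))
        w≡ : w i′ ≡ w i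
        w≡ = *-cancelˡ-≡ (w i′) (w i) (p j′) {{p-nonZero j′}} (trans (cong (_* w i′) (sym p≡)) eq)

      -- The reasons for excluding a pair: ℓ² divides x or F with ℓ ≤ B, where b numbers a block of
      -- ℓ² consecutive j; or ℓ² divides F with ℓ > B, where one key serves the whole grid.
      data Key : Set where
        linear quadratic : (ℓ i b : ℕ) → Key
        large            : (ℓ : ℕ) → Key

      InBlock : ℕ → ℕ → ℕ → Set
      InBlock ℓ b j = b * (ℓ * ℓ) ≤ j × j < b * (ℓ * ℓ) + ℓ * ℓ

      module _ {ℓ} (ℓ-prime : Prime ℓ) (ℓ∤s : ¬ ℓ ∣ s) where

        same-block : ∀ {b j j′} → InBlock ℓ b j → InBlock ℓ b j′ → + (ℓ * ℓ) ∣ℤ + j ℤ.- + j′ → j ≡ j′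
        same-block (b≤j , j<) (b≤j′ , j′<) ℓ²∣ = close-multiples ℓ²∣
          (<-≤-trans j< (+-monoˡ-≤ (ℓ * ℓ) b≤j′)) (<-≤-trans j′< (+-monoˡ-≤ (ℓ * ℓ) b≤j))

        -- As a function of j, x has slope s, a unit modulo ℓ². So the excluded j fill one class,
        -- which a block meets once.
        linear-injective : ∀ {b j j′} → InBlock ℓ b j → InBlock ℓ b j′ →
          ℓ * ℓ ∣ x j → ℓ * ℓ ∣ x j′ → j ≡ j′
        linear-injective {b} {j} {j′} bj bj′ ℓ²∣x ℓ²∣x′ = same-block {b} {j} {j′} bj bj′
          (square-euclid (+ s) _ ℓ-prime (λ ℓ∣s → ℓ∤s (∣⇒∣ᵤ ℓ∣s))
            (subst (+ (ℓ * ℓ) ∣ℤ_) difference (ℤ.∣m∣n⇒∣m-n (∣⇒+∣+ ℓ²∣x) (∣⇒+∣+ ℓ²∣x′))))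
          where
          identity : ∀ y s j j′ → (y ℤ.+ s ℤ.* j) ℤ.- (y ℤ.+ s ℤ.* j′) ≡ s ℤ.* (j ℤ.- j′)
          identity = ℤ-Solver.solve-∀
          difference : + x j ℤ.- + x j′ ≡ + s ℤ.* (+ j ℤ.- + j′)
          difference = trans (cong₂ ℤ._-_ (+x≡ j) (+x≡ j′)) (identity (+ y) (+ s) (+ j) (+ j′))

        -- The difference equals w u² s (j - j′). The primes of w divide s, so ℓ divides neither w
        -- nor s; nor does it divide u, which divides p, because ℓ ∣ F.
        same-root-injective : ∀ {b i j j′} → InBlock ℓ b j → InBlock ℓ b j′ → + ℓ ∣ℤ F i j →
          + (ℓ * ℓ) ∣ℤ + p j ℤ.* + w i ℤ.- + p j′ ℤ.* + w i → j ≡ j′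
        same-root-injective {b} {i} {j} {j′} bj bj′ ℓ∣F ℓ²∣ = same-block {b} {j} {j′} bj bj′
          (square-euclid (+ (w i * (u * u * s))) _ ℓ-prime ℓ∤wu²s (subst (+ (ℓ * ℓ) ∣ℤ_) difference ℓ²∣))
          where
          ℓ∤u : ¬ ℓ ∣ u
          ℓ∤u ℓ∣u = ∣F⇒∤p ℓ-prime {i} {j} ℓ∣F (∣m⇒∣m*n (x j) (∣m⇒∣m*n u ℓ∣u))
          ℓ∤wu²s : ¬ + ℓ ∣ℤ + (w i * (u * u * s))
          ℓ∤wu²s ℓ∣ with euclidsLemma (w i) (u * u * s) ℓ-prime (∣⇒∣ᵤ ℓ∣)
          ... | inj₁ ℓ∣w = ℓ∤s (∣w⇒∣s ℓ-prime {i} ℓ∣w)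
          ... | inj₂ ℓ∣u²s with euclidsLemma (u * u) s ℓ-prime ℓ∣u²s
          ...   | inj₁ ℓ∣u² = [ ℓ∤u , ℓ∤u ]′ (euclidsLemma u u ℓ-prime ℓ∣u²)
          ...   | inj₂ ℓ∣s = ℓ∤s ℓ∣s
          +p≡′ : ∀ j → + p j ≡ + (u * u) ℤ.* (+ y ℤ.+ + s ℤ.* + j)
          +p≡′ j = trans (ℤ.pos-* (u * u) (x j)) (cong (ℤ._*_ (+ (u * u))) (+x≡ j))
          identity : ∀ w U y s j j′ → U ℤ.* (y ℤ.+ s ℤ.* j) ℤ.* w ℤ.- U ℤ.* (y ℤ.+ s ℤ.* j′) ℤ.* w
            ≡ w ℤ.* (U ℤ.* s) ℤ.* (j ℤ.- j′)
          identity = ℤ-Solver.solve-∀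
          difference : + p j ℤ.* + w i ℤ.- + p j′ ℤ.* + w i ≡ + (w i * (u * u * s)) ℤ.* (+ j ℤ.- + j′)
          difference = trans (cong₂ (λ p p′ → p ℤ.* + w i ℤ.- p′ ℤ.* + w i) (+p≡′ j) (+p≡′ j′))
            (trans (identity (+ w i) (+ (u * u)) (+ y) (+ s) (+ j) (+ j′))
              (cong (ℤ._* (+ j ℤ.- + j′)) (sym (trans (ℤ.pos-* (w i) (u * u * s))
                (cong (ℤ._*_ (+ w i)) (ℤ.pos-* (u * u) s))))))

        -- Two products below ℓ² that agree modulo ℓ² are equal, so the fractions p/w coincide.
        large-injective : ∀ {i j i′ j′} → p j * w i′ < ℓ * ℓ → p j′ * w i < ℓ * ℓ →
          + (ℓ * ℓ) ∣ℤ + p j ℤ.* + w i′ ℤ.- + p j′ ℤ.* + w i → (i , j) ≡ (i′ , j′)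
        large-injective {i} {j} {i′} {j′} pw′<ℓ² p′w<ℓ² ℓ²∣
          with refl , refl ← proportional⇒equal {i} {j} {i′} {j′} (close-multiples
                 (subst (+ (ℓ * ℓ) ∣ℤ_) (sym (cong₂ ℤ._-_ (ℤ.pos-* (p j) (w i′)) (ℤ.pos-* (p j′) (w i)))) ℓ²∣)
                 (<-≤-trans pw′<ℓ² (m≤n+m (ℓ * ℓ) _)) (<-≤-trans p′w<ℓ² (m≤n+m (ℓ * ℓ) _))) = refl

      -- The sieve: fewer pairs are excluded than the grid contains.

      module Sieve (l H R B C : ℕ) (small-prime∣s : ∀ {ℓ} → Prime ℓ → ℓ ≤ suc l → ℓ ∣ s) (2∣s : 2 ∣ s)
        (g-squareFree : SquareFree g)
        (3w≤y : ∀ {i} → i < H → 3 * w i ≤ y)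
        (2p≤CR : ∀ {j} → j < R → 2 * p j ≤ C * R)
        (pw≤B² : ∀ {i j} → i < H → j < R → p j * w i ≤ B * B)
        (few-keys : (H * (R / suc l + B) + (H * (R / suc l + B) + suc (C * R))) * 2 < H * R) where

        -- A `large` key records i < H and j < R because the bound p w ≤ B² < ℓ² depends on them.
        Hit : Key → ℕ × ℕ → Set
        Hit (linear ℓ i b)    (i′ , j) = i ≡ i′ × InBlock ℓ b j × Prime ℓ × ¬ ℓ ∣ s × ℓ * ℓ ∣ x j
        Hit (quadratic ℓ i b) (i′ , j) = i ≡ i′ × InBlock ℓ b j × Prime ℓ × ¬ ℓ ∣ s × + (ℓ * ℓ) ∣ℤ F i′ j
        Hit (large ℓ)         (i , j)  = i < H × j < R × B < ℓ × Prime ℓ × ¬ ℓ ∣ s × + (ℓ * ℓ) ∣ℤ F i j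

        roots : ∀ {ℓ} → Prime ℓ → ¬ ℓ ∣ s → ∀ i₁ j₁ i₂ j₂ i₃ j₃ →
          + (ℓ * ℓ) ∣ℤ F i₁ j₁ → + (ℓ * ℓ) ∣ℤ F i₂ j₂ → + (ℓ * ℓ) ∣ℤ F i₃ j₃ →
          + (ℓ * ℓ) ∣ℤ + p j₁ ℤ.* + w i₂ ℤ.- + p j₂ ℤ.* + w i₁ ⊎
          + (ℓ * ℓ) ∣ℤ + p j₁ ℤ.* + w i₃ ℤ.- + p j₃ ℤ.* + w i₁ ⊎
          + (ℓ * ℓ) ∣ℤ + p j₂ ℤ.* + w i₃ ℤ.- + p j₃ ℤ.* + w i₂
        roots {ℓ} ℓ-prime ℓ∤s i₁ j₁ i₂ j₂ i₃ j₃ =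
          -- From 2 ∣ s and ℓ ∤ s, the prime ℓ is odd.
          two-roots {ε} (sign-squared γ) ℓ-prime (λ ℓ∣2 → ℓ∤s (∣-trans (∣⇒∣ᵤ ℓ∣2) 2∣s))
            (+ p j₁) (+ w i₁) (+ p j₂) (+ w i₂) (+ p j₃) (+ w i₃) (ℓ∤w i₁) (ℓ∤w i₂) (ℓ∤w i₃)
          where
          ℓ∤w : ∀ i → ¬ + ℓ ∣ℤ + w i
          ℓ∤w i ℓ∣w = ℓ∤s (∣w⇒∣s ℓ-prime {i} (∣⇒∣ᵤ ℓ∣w))

        -- A `linear` key holds a single pair. Otherwise two of the three pairs share a root p/w
        -- modulo ℓ², and sharing a root forces equality: inside a block for `quadratic`, on the
        -- whole grid for `large`.
        at-most-two-hits : ∀ {κ a b c} → Hit κ a → Hit κ b → Hit κ c → a ≡ b ⊎ a ≡ c ⊎ b ≡ c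
        at-most-two-hits {linear ℓ i b} {_ , j} {_ , j′} (refl , bj , ℓ-prime , ℓ∤s , d) (refl , bj′ , _ , _ , d′) _ =
          inj₁ (cong (i ,_) (linear-injective ℓ-prime ℓ∤s {b} bj bj′ d d′))
        at-most-two-hits {quadratic ℓ i b} {_ , j₁} {_ , j₂} {_ , j₃}
          (refl , bj₁ , ℓ-prime , ℓ∤s , d₁) (refl , bj₂ , _ , _ , d₂) (refl , bj₃ , _ , _ , d₃) =
          Sum.map (coincide bj₁ bj₂ d₁) (Sum.map (coincide bj₁ bj₃ d₁) (coincide bj₂ bj₃ d₂))
            (roots ℓ-prime ℓ∤s i j₁ i j₂ i j₃ d₁ d₂ d₃)
          where
          coincide : ∀ {j j′} → InBlock ℓ b j → InBlock ℓ b j′ → + (ℓ * ℓ) ∣ℤ F i j →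
            + (ℓ * ℓ) ∣ℤ + p j ℤ.* + w i ℤ.- + p j′ ℤ.* + w i → (i , j) ≡ (i , j′)
          coincide {j} {j′} bj bj′ d e = cong (i ,_) (same-root-injective ℓ-prime ℓ∤s {b} {i} {j} {j′} bj bj′ (ℓ²∣⇒ℓ∣ d) e)
        at-most-two-hits {large ℓ} {i₁ , j₁} {i₂ , j₂} {i₃ , j₃}
          (i₁< , j₁< , B<ℓ , ℓ-prime , ℓ∤s , d₁) (i₂< , j₂< , _ , _ , _ , d₂) (i₃< , j₃< , _ , _ , _ , d₃) =
          Sum.map (coincide i₁< j₁< i₂< j₂<) (Sum.map (coincide i₁< j₁< i₃< j₃<) (coincide i₂< j₂< i₃< j₃<))
            (roots ℓ-prime ℓ∤s i₁ j₁ i₂ j₂ i₃ j₃ d₁ d₂ d₃)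
          where
          coincide : ∀ {i j i′ j′} → i < H → j < R → i′ < H → j′ < R →
            + (ℓ * ℓ) ∣ℤ + p j ℤ.* + w i′ ℤ.- + p j′ ℤ.* + w i → (i , j) ≡ (i′ , j′)
          coincide i< j< i′< j′< = large-injective ℓ-prime ℓ∤s
            (≤-<-trans (pw≤B² i′< j<) (*-mono-< B<ℓ B<ℓ)) (≤-<-trans (pw≤B² i< j′<) (*-mono-< B<ℓ B<ℓ))

        keys : List Key
        keys = blockKeys linear l H R B ++ blockKeys quadratic l H R B ++ map large (upTo (suc (C * R)))

        length-keys : length keys ≤ H * (R / suc l + B) + (H * (R / suc l + B) + suc (C * R))
        length-keys = begin
          length keys
            ≡⟨ trans (length-++ (blockKeys linear l H R B)) (cong (_+_ (length (blockKeys linear l H R B))) (length-++ (blockKeys quadratic l H R B))) ⟩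
          length (blockKeys linear l H R B) + (length (blockKeys quadratic l H R B) + length (map large (upTo (suc (C * R)))))
            ≤⟨ +-mono-≤ (length-blockKeys linear l H R B) (+-mono-≤ (length-blockKeys quadratic l H R B)
                 (≤-reflexive (trans (length-map large (upTo (suc (C * R)))) (length-upTo (suc (C * R)))))) ⟩
          H * (R / suc l + B) + (H * (R / suc l + B) + suc (C * R)) ∎
          where open ≤-Reasoning

        Good : ℕ × ℕ → Set
        Good (i , j) = i < H × ∃ λ f → F i j ≡ + f × 0 < f × SquareFree (g * (x j * f))

        -- Suppose ℓ² ∣ g x f with ℓ prime. If ℓ ∣ s, then ℓ ∤ x f, so ℓ² ∣ g, which is square-free.
        -- If ℓ ∤ s, then ℓ ∤ g, and ℓ cannot divide both x and F because x divides p. So ℓ² divides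
        -- x or f, and the size of ℓ selects the key.
        good-or-hit : ∀ {i j} → i < H → j < R → Good (i , j) ⊎ Any (λ κ → Hit κ (i , j)) keys
        good-or-hit {i} {j} i<H j<R
          with form-value γ (≤-trans (3w≤y i<H) (≤-trans (y≤x j) (x≤p j))) (0<w i)
        ... | f , F≡f , 0<f , f≤ with prime-square-divisor (g * (x j * f)) {{n-nonZero}}
          where
          instance
            xf-nonZero : NonZero (x j * f)
            xf-nonZero = m*n≢0 (x j) f {{>-nonZero (≤-trans (>-nonZero⁻¹ y) (y≤x j))}} {{>-nonZero 0<f}}
          n-nonZero : NonZero (g * (x j * f))
          n-nonZero = m*n≢0 g (x j * f)
        ...   | inj₁ squareFree = inj₁ (i<H , f , F≡f , 0<f , squareFree)
        ...   | inj₂ (ℓ , ℓ-prime , ℓ²∣n) = inj₂ (hit (ℓ ∣? s))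
          where
          instance
            ℓ²-nonZero : NonZero (ℓ * ℓ)
            ℓ²-nonZero = m*n≢0 ℓ ℓ {{prime⇒nonZero ℓ-prime}} {{prime⇒nonZero ℓ-prime}}
          b = j / (ℓ * ℓ)
          bℓ²≤j : b * (ℓ * ℓ) ≤ j
          bℓ²≤j = m/n*n≤m j (ℓ * ℓ)
          in-block : InBlock ℓ b j
          in-block = bℓ²≤j , subst (_< b * (ℓ * ℓ) + ℓ * ℓ)
            (trans (+-comm (b * (ℓ * ℓ)) (j % (ℓ * ℓ))) (sym (m≡m%n+[m/n]*n j (ℓ * ℓ)))) (+-monoʳ-< (b * (ℓ * ℓ)) (m%n<n j (ℓ * ℓ)))
          ∈-block : ∀ key → ¬ ℓ ∣ s → ℓ ≤ B → key ℓ i b ∈ blockKeys key l H R B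
          ∈-block key ℓ∤s ℓ≤B = ∈-blockKeys key l H R B (≰⇒> λ ℓ≤l → ℓ∤s (small-prime∣s ℓ-prime ℓ≤l))
            (≤-trans ℓ≤B (m≤n+m B (suc l))) i<H (≤-trans bℓ²≤j (<⇒≤ j<R))
          hit-linear : ¬ ℓ ∣ s → ℓ * ℓ ∣ x j → Any (λ κ → Hit κ (i , j)) keys
          -- Here ℓ² ≤ x ≤ p w ≤ B², so x never calls for a large prime.
          hit-linear ℓ∤s ℓ²∣x = lose (∈-++⁺ˡ (∈-block linear ℓ∤s (square-cancel-≤ (begin
            ℓ * ℓ      ≤⟨ ∣⇒≤ {{>-nonZero (≤-trans (>-nonZero⁻¹ y) (y≤x j))}} ℓ²∣x ⟩
            x j        ≤⟨ x≤p j ⟩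
            p j        ≤⟨ m≤m*n (p j) (w i) {{>-nonZero (0<w i)}} ⟩
            p j * w i  ≤⟨ pw≤B² i<H j<R ⟩
            B * B      ∎)))) (refl , in-block , ℓ-prime , ℓ∤s , ℓ²∣x)
            where open ≤-Reasoning
          hit-form : ¬ ℓ ∣ s → ℓ * ℓ ∣ f → Dec (ℓ ≤ B) → Any (λ κ → Hit κ (i , j)) keys
          hit-form ℓ∤s ℓ²∣f (yes ℓ≤B) = lose (∈-++⁺ʳ (blockKeys linear l H R B) (∈-++⁺ˡ (∈-block quadratic ℓ∤s ℓ≤B)))
            (refl , in-block , ℓ-prime , ℓ∤s , subst (+ (ℓ * ℓ) ∣ℤ_) (sym F≡f) (∣⇒+∣+ ℓ²∣f))
          -- Here ℓ² ≤ f ≤ (2p)² ≤ (C R)², so ℓ occurs among the large keys.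
          hit-form ℓ∤s ℓ²∣f (no ℓ≰B) = lose (∈-++⁺ʳ (blockKeys linear l H R B) (∈-++⁺ʳ (blockKeys quadratic l H R B)
              (∈-map⁺ large (∈-upTo⁺ (s≤s (≤-trans
                (square-cancel-≤ (≤-trans (∣⇒≤ {{>-nonZero 0<f}} ℓ²∣f) f≤)) (2p≤CR j<R)))))))
            (i<H , j<R , ≰⇒> ℓ≰B , ℓ-prime , ℓ∤s , subst (+ (ℓ * ℓ) ∣ℤ_) (sym F≡f) (∣⇒+∣+ ℓ²∣f))
          hit-xf : ¬ ℓ ∣ s → ℓ * ℓ ∣ x j * f → Dec (ℓ ∣ x j) → Any (λ κ → Hit κ (i , j)) keys
          hit-xf ℓ∤s ℓ²∣xf (yes ℓ∣x) = hit-linear ℓ∤s (square-euclidℕ f (x j) ℓ-prime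
            (λ ℓ∣f → ∣F⇒∤p ℓ-prime {i} {j} (subst (+ ℓ ∣ℤ_) (sym F≡f) (∣⇒+∣+ ℓ∣f)) (∣n⇒∣m*n (u * u) ℓ∣x))
            (subst (ℓ * ℓ ∣_) (*-comm (x j) f) ℓ²∣xf))
          hit-xf ℓ∤s ℓ²∣xf (no ℓ∤x) = hit-form ℓ∤s (square-euclidℕ (x j) f ℓ-prime ℓ∤x ℓ²∣xf) (ℓ ≤? B)
          hit : Dec (ℓ ∣ s) → Any (λ κ → Hit κ (i , j)) keys
          hit (yes ℓ∣s) = contradiction (subst Prime (g-squareFree ℓ (square-euclidℕ (x j * f) g ℓ-prime
              (λ ℓ∣xf → ∣xF⇒∤s ℓ-prime {i} {j} (subst (+ ℓ ∣ℤ_)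
                (trans (ℤ.pos-* (x j) f) (cong (ℤ._*_ (+ x j)) (sym F≡f))) (∣⇒+∣+ ℓ∣xf)) ℓ∣s)
              (subst (ℓ * ℓ ∣_) (*-comm g (x j * f)) ℓ²∣n))) ℓ-prime) ¬prime[1]
          hit (no ℓ∤s) = hit-xf ℓ∤s (square-euclidℕ g (x j * f) ℓ-prime (λ ℓ∣g → ℓ∤s (∣-trans ℓ∣g g∣s)) ℓ²∣n) (ℓ ∣? x j)

        all-pairs : List (ℕ × ℕ)
        all-pairs = cartesianProduct (upTo H) (upTo R)

        good-pair : ∃ Good
        good-pair with first-or-all {P = Good} (All.tabulate {xs = all-pairs} λ ij∈ →
            let i∈ , j∈ = ∈-cartesianProduct⁻ (upTo H) (upTo R) ij∈ in good-or-hit (∈-upTo⁻ i∈) (∈-upTo⁻ j∈))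
        ... | inj₁ good = good
        ... | inj₂ hits = contradiction (begin-strict
          H * R ≡⟨ cong₂ _*_ (length-upTo H) (length-upTo R) ⟨
          length (upTo H) * length (upTo R) ≡⟨ length-cartesianProductWith _,_ (upTo H) (upTo R) ⟨
          length all-pairs ≤⟨ pigeonhole₂ {Hit = Hit} (λ {κ} → at-most-two-hits {κ}) keys
            (Unique.cartesianProduct⁺ (Unique.upTo⁺ H) (Unique.upTo⁺ R)) hits ⟩
          length keys * 2 ≤⟨ *-monoˡ-≤ 2 length-keys ⟩
          (H * (R / suc l + B) + (H * (R / suc l + B) + suc (C * R))) * 2 <⟨ few-keys ⟩
          H * R ∎) (<-irrefl refl)
          where open ≤-Reasoning

  -- Choice of the parameters and construction of n = g h.

  few-keys : ∀ C B R q → 1 < C * R → 16 * q ≤ R → 16 * B ≤ R →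
    (8 * C * (q + B) + (8 * C * (q + B) + suc (C * R))) * 2 < 8 * C * R
  few-keys C B R q 1<CR 16q≤R 16B≤R = begin-strict
    (8 * C * (q + B) + (8 * C * (q + B) + suc (C * R))) * 2
      ≡⟨ expand C B R q ⟩
    -- With H = 8 C, the grid has four times 2 C R pairs. One share covers the terms with q, one
    -- those with B, one the large keys, and the last exceeds the remaining 2.
    2 * (C * (16 * q)) + 2 * (C * (16 * B)) + 2 * (C * R) + 2
      ≤⟨ +-monoˡ-≤ 2 (+-monoˡ-≤ (2 * (C * R)) (+-mono-≤ (*-monoʳ-≤ 2 (*-monoʳ-≤ C 16q≤R)) (*-monoʳ-≤ 2 (*-monoʳ-≤ C 16B≤R)))) ⟩
    2 * (C * R) + 2 * (C * R) + 2 * (C * R) + 2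
      <⟨ +-monoʳ-< (2 * (C * R) + 2 * (C * R) + 2 * (C * R)) (*-monoʳ-< 2 1<CR) ⟩
    2 * (C * R) + 2 * (C * R) + 2 * (C * R) + 2 * (C * R)
      ≡⟨ collect C R ⟩
    8 * C * R ∎
    where
    open ≤-Reasoning
    expand : ∀ C B R q → (8 * C * (q + B) + (8 * C * (q + B) + (1 + C * R))) * 2
      ≡ 2 * (C * (16 * q)) + 2 * (C * (16 * B)) + 2 * (C * R) + 2
    expand = solve-∀
    collect : ∀ C R → 2 * (C * R) + 2 * (C * R) + 2 * (C * R) + 2 * (C * R) ≡ 8 * C * R
    collect = solve-∀

  module _ (γ : Angle) (u g s : ℕ) .{{_ : NonZero u}} .{{_ : NonZero g}} (1<s : 1 < s)
    (g∣s : g ∣ s) (g-squareFree : SquareFree g) (u⊥s : NoCommonPrime u s)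
    (small-prime∣s : ∀ {ℓ} → Prime ℓ → ℓ ≤ 16 → ℓ ∣ s) where

    squareFree-congruent : ∀ N → ∃ λ h → + s ∣ℤ + h ℤ.- + u × N < g * h × SquareFree (g * h) × CongruentTriangle γ (g * h)
    squareFree-congruent N with y , uy≡1 ← inverse {u} {s} (noCommonPrime⇒coprime {{>-nonZero (<-trans z<s 1<s)}} u⊥s) = conclude S.good-pair
      where
      instance
        s-nonZero : NonZero s
        s-nonZero = >-nonZero (<-trans z<s 1<s)
        u²-nonZero : NonZero (u * u)
        u²-nonZero = m*n≢0 u u
      -- The bound ℓ ≤ C R does not involve H, so H can be chosen after C.  The
      -- start y₀ ≥ 3W of the progression makes F positive, and B² = C W R.
      C = 2 * (u * u) * suc s
      H = 8 * C
      W = g * (s ^ suc H * s ^ suc H)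
      y₀ = y + s * suc (3 * W + N)
      y₀-large : suc (3 * W + N) ≤ y₀
      y₀-large = ≤-trans (m≤n*m (suc (3 * W + N)) s) (m≤n+m _ y)
      instance
        y₀-nonZero : NonZero y₀
        y₀-nonZero = >-nonZero (≤-trans (s≤s z≤n) y₀-large)
      module G₀ = Grid γ u g s y 1<s g∣s u⊥s uy≡1
      -- The new start y₀ is the term `x (suc (3 * W + N))` of `G₀`, which supplies its congruence u
      -- y₀ ≡ 1.
      module G = Grid γ u g s y₀ 1<s g∣s u⊥s (G₀.ux≡1 (suc (3 * W + N)))
      -- With R = B E, the factor 16 gives 16 B ≤ R, and the factor `suc y₀` gives y₀ ≤ R. For j < R
      -- this yields y₀ + s j ≤ (1 + s) R, whence the `suc s` in C.
      E = 16 * suc y₀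
      B = C * W * E
      R = B * E
      1≤W : 1 ≤ W
      1≤W = G.0<w H
      2≤C : 2 ≤ C
      2≤C = *-mono-≤ (m≤m*n 2 (u * u)) (s≤s z≤n)
      16≤E : 16 ≤ E
      16≤E = m≤m*n 16 (suc y₀)
      1≤E : 1 ≤ E
      1≤E = ≤-trans (s≤s z≤n) 16≤E
      1≤B : 1 ≤ B
      1≤B = *-mono-≤ (*-mono-≤ (<⇒≤ 2≤C) 1≤W) 1≤E
      1≤R : 1 ≤ R
      1≤R = *-mono-≤ 1≤B 1≤E
      y₀≤R : y₀ ≤ R
      y₀≤R = ≤-trans (n≤1+n y₀) (≤-trans (m≤n*m (suc y₀) 16) (m≤n*m E B {{>-nonZero 1≤B}}))
      3w≤y₀ : ∀ {i} → i < H → 3 * G.w i ≤ y₀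
      3w≤y₀ i<H = ≤-trans (*-monoʳ-≤ 3 (G.w-mono-≤ (<⇒≤ i<H)))
        (≤-trans (m≤m+n (3 * W) N) (≤-trans (n≤1+n _) y₀-large))
      2p≤CR : ∀ {j} → j < R → 2 * G.p j ≤ C * R
      2p≤CR {j} j<R = begin
        2 * (u * u * (y₀ + s * j))   ≡⟨ *-assoc 2 (u * u) (y₀ + s * j) ⟨
        2 * (u * u) * (y₀ + s * j)   ≤⟨ *-monoʳ-≤ (2 * (u * u)) (+-mono-≤ y₀≤R (*-monoʳ-≤ s (<⇒≤ j<R))) ⟩
        2 * (u * u) * (suc s * R)    ≡⟨ *-assoc (2 * (u * u)) (suc s) R ⟨
        C * R                        ∎
        where open ≤-Reasoning
      pw≤B² : ∀ {i j} → i < H → j < R → G.p j * G.w i ≤ B * B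
      pw≤B² {i} {j} i<H j<R = begin
        G.p j * G.w i  ≤⟨ *-mono-≤ (≤-trans (m≤n*m (G.p j) 2) (2p≤CR {j} j<R)) (G.w-mono-≤ (<⇒≤ i<H)) ⟩
        C * (B * E) * W ≡⟨ rearrange B C W E ⟩
        B * (C * W * E) ∎
        where
        open ≤-Reasoning
        rearrange : ∀ B C W E → C * (B * E) * W ≡ B * (C * W * E)
        rearrange = solve-∀
      16q≤R : 16 * (R / 16) ≤ R
      16q≤R = subst (_≤ R) (*-comm (R / 16) 16) (m/n*n≤m R 16)
      16B≤R : 16 * B ≤ R
      16B≤R = subst (_≤ R) (*-comm B 16) (*-monoʳ-≤ B 16≤E)
      -- All primes up to `suc l = 16` divide s, so the sum of 1/ℓ² over the remaining ℓ is at most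
      -- 1/16, the share that `few-keys` allows.
      module S = G.Sieve 15 H R B C small-prime∣s (small-prime∣s prime[2] (s≤s (s≤s z≤n))) g-squareFree
        3w≤y₀ (λ {j} → 2p≤CR {j}) (λ {i} {j} → pw≤B² {i} {j})
        (few-keys C B R (R / 16) (*-mono-≤ 2≤C 1≤R) 16q≤R 16B≤R)
      conclude : ∃ S.Good → ∃ λ h → + s ∣ℤ + h ℤ.- + u × N < g * h × SquareFree (g * h) × CongruentTriangle γ (g * h)
      conclude ((i , j) , i<H , f , F≡f , 0<f , squareFree) = h , h≡u , N<n , squareFree ,
        triangle γ {d = + (u * G.t i)} {+ G.p j} {+ G.w i} (ℤ.+<+ (*-mono-≤ (>-nonZero⁻¹ u) (G.0<t i)))
          (ℤ.+<+ (≤-trans (s≤s z≤n) (≤-trans N<x (G.x≤p j)))) (ℤ.+<+ (G.0<w i))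
          (subst (+ 0 ℤ.<_) (sym F≡f) (ℤ.+<+ 0<f)) area
        where
        h = G.x j * f
        h≡u : + s ∣ℤ + h ℤ.- + u
        h≡u = subst (λ z → + s ∣ℤ z ℤ.- + u) (trans (cong (ℤ._*_ (+ G.x j)) F≡f) (sym (ℤ.pos-* (G.x j) f))) (G.xF≡u i j)
        -- The summand N in y₀ makes x, and with it n = g x f, exceed N.
        N<x : N < G.x j
        N<x = ≤-trans (s≤s (m≤n+m N (3 * W))) (≤-trans y₀-large (G.y≤x j))
        N<n : N < g * h
        N<n = ≤-trans N<x (≤-trans (m≤m*n (G.x j) f {{>-nonZero 0<f}}) (m≤n*m h g))
        regroup : ∀ u x g t f → u * u * x * (g * (t * t)) * f ≡ g * (x * f) * (u * t * (u * t))
        regroup = solve-∀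
        area : + G.p j ℤ.* + G.w i ℤ.* G.F i j ≡ + (g * h) ℤ.* (+ (u * G.t i) ℤ.* + (u * G.t i))
        area = begin
          + G.p j ℤ.* + G.w i ℤ.* G.F i j     ≡⟨ cong₂ ℤ._*_ (sym (ℤ.pos-* (G.p j) (G.w i))) F≡f ⟩
          + (G.p j * G.w i) ℤ.* + f           ≡⟨ ℤ.pos-* (G.p j * G.w i) f ⟨
          + (G.p j * G.w i * f)               ≡⟨ cong +_ (regroup u (G.x j) g (G.t i) f) ⟩
          + (g * h * (u * G.t i * (u * G.t i))) ≡⟨ ℤ.pos-* (g * h) _ ⟩
          + (g * h) ℤ.* + (u * G.t i * (u * G.t i)) ≡⟨ cong (ℤ._*_ (+ (g * h))) (ℤ.pos-* (u * G.t i) (u * G.t i)) ⟩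
          + (g * h) ℤ.* (+ (u * G.t i) ℤ.* + (u * G.t i)) ∎
          where open ≡-Reasoning

  -- Reduction from the class of a modulo m to that of u modulo s.

  squareFree-∣ : ∀ {m n} → m ∣ n → SquareFree n → SquareFree m
  squareFree-∣ m∣n squareFree d d²∣m = squareFree d (∣-trans d²∣m m∣n)

  ≤⇒∣! : ∀ {m n} .{{_ : NonZero m}} → m ≤ n → m ∣ n !
  ≤⇒∣! {suc m} m≤n = ∣-trans (m∣m*n (m !)) (m≤n⇒m!∣n! m≤n)

  -- Dividing the remainder r of a and the modulus by g leaves a coprime pair, so some u = r/g +
  -- (m/g) t is prime to s = m Q. If h ≡ u modulo s, then g h ≡ g u = r + m t ≡ a modulo m.
  squareFree-congruent-mod : ∀ m a Q .{{_ : NonZero m}} .{{_ : NonZero Q}} → 1 < m →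
    (∀ {ℓ} → Prime ℓ → ℓ ≤ 16 → ℓ ∣ Q) → SquareFree ℤ.∣ ℤ.gcd a (+ m) ∣ → ∀ γ →
    Infinitely (λ n → (+ n) ≡ a [mod + m ] × SquareFree n × Congruent γ n)
  squareFree-congruent-mod m a Q 1<m small-prime∣Q gcd-squareFree γ N =
    conclude (coprime-in-progression (coprime-/gcd r m) s)
    where
    r = a ℤ.%ℕ m
    q = a ℤ./ℕ m
    g = gcd r m
    s = m * Q
    a≡r+qm : a ≡ + r ℤ.+ q ℤ.* + m
    a≡r+qm = ℤ.a≡a%ℕn+[a/ℕn]*n a m
    g∣r : g ∣ r
    g∣r = gcd[m,n]∣m r m
    g∣m : g ∣ m
    g∣m = gcd[m,n]∣n r m
    instance
      g-nonZero : NonZero g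
      g-nonZero = ≢-nonZero (gcd[m,n]≢0 r m (inj₂ (≢-nonZero⁻¹ m)))
      s-nonZero : NonZero s
      s-nonZero = m*n≢0 m Q
    g∣a : + g ∣ℤ a
    g∣a = subst (+ g ∣ℤ_) (sym a≡r+qm) (ℤ.∣m∣n⇒∣m+n (∣⇒+∣+ g∣r) (ℤ.∣n⇒∣m*n q (∣⇒+∣+ g∣m)))
    g-squareFree : SquareFree g
    g-squareFree = squareFree-∣ (gcd-greatest (∣⇒∣ᵤ g∣a) g∣m) gcd-squareFree
    small-prime∣s : ∀ {ℓ} → Prime ℓ → ℓ ≤ 16 → ℓ ∣ s
    small-prime∣s ℓ-prime ℓ≤16 = ∣n⇒∣m*n m (small-prime∣Q ℓ-prime ℓ≤16)
    module _ (t : ℕ) where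
      u = r / g + m / g * t
      -- As s is even, u = 0 would share the prime 2 with it.
      u-nonZero : NoCommonPrime u s → NonZero u
      u-nonZero u⊥s = ≢-nonZero λ u≡0 →
        u⊥s prime[2] (subst (2 ∣_) (sym u≡0) (2 ∣0)) (small-prime∣s prime[2] (s≤s (s≤s z≤n)))
      gu≡r+mt : g * u ≡ r + m * t
      gu≡r+mt = begin
        g * (r / g + m / g * t)       ≡⟨ *-distribˡ-+ g (r / g) (m / g * t) ⟩
        g * (r / g) + g * (m / g * t) ≡⟨ cong₂ _+_ (m*[n/m]≡n g∣r)
                                           (trans (sym (*-assoc g (m / g) t)) (cong (_* t) (m*[n/m]≡n g∣m))) ⟩
        r + m * t                     ∎
        where open ≡-Reasoning
      n≡a : ∀ h → + s ∣ℤ + h ℤ.- + u → + (g * h) ≡ a [mod + m ]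
      n≡a h h≡u = ∣⇒∣ᵤ (subst (+ m ∣ℤ_) (begin
        + g ℤ.* (+ h ℤ.- + u) ℤ.+ (+ t ℤ.- q) ℤ.* + m
          ≡⟨ expand (+ g) (+ h) (+ u) (+ t) q (+ m) ⟩
        + g ℤ.* + h ℤ.- (+ g ℤ.* + u ℤ.- + m ℤ.* + t ℤ.+ q ℤ.* + m)
          ≡⟨ cong₂ (λ x y → x ℤ.- (y ℤ.- + m ℤ.* + t ℤ.+ q ℤ.* + m)) (ℤ.pos-* g h) +[r+mt]≡ ⟨
        + (g * h) ℤ.- (+ r ℤ.+ + m ℤ.* + t ℤ.- + m ℤ.* + t ℤ.+ q ℤ.* + m)
          ≡⟨ cong (λ x → + (g * h) ℤ.- (x ℤ.+ q ℤ.* + m)) (cancel (+ r) (+ m ℤ.* + t)) ⟩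
        + (g * h) ℤ.- (+ r ℤ.+ q ℤ.* + m)
          ≡⟨ cong (ℤ._-_ (+ (g * h))) a≡r+qm ⟨
        + (g * h) ℤ.- a ∎)
        (ℤ.∣m∣n⇒∣m+n (ℤ.∣n⇒∣m*n (+ g) (ℤ.∣-trans (∣⇒+∣+ (m∣m*n Q)) h≡u)) (ℤ.∣n⇒∣m*n (+ t ℤ.- q) ℤ.∣-refl)))
        where
        open ≡-Reasoning
        expand : ∀ g h u t q m → g ℤ.* (h ℤ.- u) ℤ.+ (t ℤ.- q) ℤ.* m ≡ g ℤ.* h ℤ.- (g ℤ.* u ℤ.- m ℤ.* t ℤ.+ q ℤ.* m)
        expand = ℤ-Solver.solve-∀
        cancel : ∀ x y → x ℤ.+ y ℤ.- y ≡ x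
        cancel = ℤ-Solver.solve-∀
        +[r+mt]≡ : + r ℤ.+ + m ℤ.* + t ≡ + g ℤ.* + u
        +[r+mt]≡ = begin
          + r ℤ.+ + m ℤ.* + t  ≡⟨ cong (ℤ._+_ (+ r)) (ℤ.pos-* m t) ⟨
          + r ℤ.+ + (m * t)    ≡⟨ ℤ.pos-+ r (m * t) ⟨
          + (r + m * t)        ≡⟨ cong +_ gu≡r+mt ⟨
          + (g * u)            ≡⟨ ℤ.pos-* g u ⟩
          + g ℤ.* + u          ∎
    conclude : (∃ λ t → NoCommonPrime (u t) s) →
      ∃ λ n → N < n × + n ≡ a [mod + m ] × SquareFree n × Congruent γ n
    conclude (t , u⊥s) = finish (squareFree-congruent γ (u t) g s {{u-nonZero t u⊥s}}
        (≤-trans 1<m (m≤m*n m Q)) (∣m⇒∣m*n Q g∣m) g-squareFree u⊥s small-prime∣s N)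
      where
      finish : (∃ λ h → + s ∣ℤ + h ℤ.- + u t × N < g * h × SquareFree (g * h) × CongruentTriangle γ (g * h)) →
        ∃ λ n → N < n × + n ≡ a [mod + m ] × SquareFree n × Congruent γ n
      finish (h , h≡u , N<n , squareFree , triangle′) =
        g * h , N<n , n≡a t h h≡u , squareFree , ≤-trans (s≤s z≤n) N<n , triangle′

open import Data.Integer using (ℤ; +_; _<_; ∣_∣)
open import Data.Integer.GCD using (gcd)
open import Data.Nat using (_!)
open import Data.Nat.Primality using (prime⇒nonZero)
open Sieving

theorem5p4 : (m a : ℤ) → + 1 < m → SquareFree ∣ gcd a m ∣ → (γ : Angle) →
    Infinitely (λ n → (+ n) ≡ a [mod m ] × SquareFree n × Congruent γ n)
theorem5p4 (+ m) a (ℤ.+<+ 1<m) gcd-squareFree =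
  -- The factorial supplies every prime up to 16, the threshold of the sieve.
  squareFree-congruent-mod m a (16 !) {{ℕ.>-nonZero (ℕ.<-trans ℕ.z<s 1<m)}} {{16 ℕ.!≢0}} 1<m
    (λ {ℓ} ℓ-prime → ≤⇒∣! {ℓ} {16} {{prime⇒nonZero ℓ-prime}}) gcd-squareFree
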